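{- Let $k\ge 2$ and $n>2^k$ be integers, let $c=2^k-2$, and consider the unit-profit search game on the path with vertex set $V=\{0,\dots,n-1\}$. Let $h,w$ be the positive integers such that $h(n-1)-wc=1$ if $\gcd(c,n-1)=1$ and $h(n-1)-wc=0$ otherwise, with $0<w\le n-2$ minimal. Then the value of the game, $$\max_{x\in\Delta_k}\ \min_{v\in V}\ \sum_{T\in\mathcal T_k:\ v\in C(T)} x_T ,$$ equals $\frac{h}{w}$. Moreover, the distribution $x$ produced by the greedy algorithm described in the context is an optimal (maximin) strategy for the seeker; if $\gcd(c,n-1)=d>1$, the hider distribution $y$ with $y_v=0$ if $v$ is a multiple of $d$ and $y_v=\frac{1}{w(d-1)}$ otherwise (where $w=(n-1)/d$) is an optimal (minimax) strategy for the hider; and if $\gcd(c,n-1)=1$, the hider distribution $y$ produced by the segment construction described in the context is an optimal strategy for the hider. In particular, in each case $(x,y)$ is a Nash equilibrium.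
   Context: Let $G$ be the path with vertex set $V=\{0,1,\dots,n-1\}$ and edges $\{v,v+1\}$ for $0\le v\le n-2$. A search strategy for a tree $H$ is a rooted binary tree $T$ whose internal nodes $\nu$ are labeled by edges $e(\nu)$ of $H$, defined recursively: a single node is a search strategy for any tree (and then its unique node has vertex set $V(H)$); otherwise the root $\rho$ is labeled by an edge $uv$ of $H$, and its two subtrees are search strategies for the two connected components $H_u\ni u$ and $H_v\ni v$ of $H-uv$. Each node $\nu$ of $T$ gets a vertex set $V(\nu)$: the root gets $V(H)$ and, recursively, the roots of the two subtrees get $V(H_u)$ and $V(H_v)$. The covered set $C(T)$ is the set of vertices $v$ such that $\{v\}=V(\lambda)$ for some leaf $\lambda$ of $T$. The height of $T$ is the maximum number of edges on a root-to-leaf path. $\mathcal T_k$ is the set of search strategies for $G$ of height at most $k$, and $\Delta_k$ is the set of probability distributions $x=(x_T)_{T\in\mathcal T_k}$ on $\mathcal T_k$; $\Delta_V$ is the set of probability distributions on $V$. For $y\in\Delta_V$ and $S\subseteq V$ write $y(S)=\sum_{v\in S}y_v$. In the unit-profit game the seeker chooses $x\in\Delta_k$, the hider chooses $y\in\Delta_V$, and the seeker's expected payoff (hider's cost) is $\sum_{T}\sum_{v} x_T y_v \mathbf 1[v\in C(T)]$; a Nash equilibrium is a pair from which no player can unilaterally improve. Interval notation: for integers $u,v$ and $r\ge1$, $[u,v]_r=\{z \bmod r: u\le z\le v\}$ if $u\le v$ and $\emptyset$ otherwise; $[u,v]=[u,v]_n$; $[v\oplus\ell]_r=[v,v+\ell-1]_r$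 and $[v\oplus\ell]=[v\oplus\ell]_n$. Efficient strategies: for each $v\in V\setminus\{1\}$, $T_v$ denotes a strategy in $\mathcal T_k$ with $C(T_v)=[v\oplus(c+1)]$ if $\{0,n-1\}\cap[v\oplus(c+1)]\neq\emptyset$ and $C(T_v)=[v\oplus c]$ otherwise (such strategies exist). Greedy algorithm for the seeker: set $v=c+1$ and $\mathcal X=\{T_0\}$; while $v\notin\{0,1\}$, add $T_v$ to $\mathcal X$ and set $v:=(v+c)\bmod (n-1)$; finally $x_T=1/|\mathcal X|$ for $T\in\mathcal X$ and $x_T=0$ otherwise. Segment construction for the hider (used when $\gcd(c,n-1)=1$, with $h,w$ as in the claim, so $h(n-1)=wc+1$): let $g(v)=v\cdot\frac{h}{wc}$ and $r=\lfloor c/h\rfloor$. Set $y_0=y_{n-1}=0$. Starting with $v=1$, repeatedly: let $r^*$ be the largest element of $\{r,r+1\}$ with $g(v+r^*-1)\le y([1,v-1])+\frac1w$ (where $y([1,v-1])$ is the mass already assigned to $1,\dots,v-1$); call $\{v,\dots,v+r^*-1\}$ a segment, set $y_i=\frac{1}{r^*w}$ for $i\in\{v,\dots,v+r^*-1\}$, and set $v:=v+r^*$; stop when $v>n-2$.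
   Formalization: The probability distributions of the seeker and the hider (in the value, in the optimality claims and in the Nash equilibrium deviations) have rational rather than real probabilities. -}

module Defs where

open import Data.Nat as ℕ using (ℕ; zero; suc; _+_; _*_; _∸_; _^_; _≤_; _<_; _≡ᵇ_; _<ᵇ_; _≤ᵇ_)
import Data.Nat.DivMod as ℕD
open import Data.Nat.GCD using (gcd)
open import Data.Bool using (Bool; true; false; _∧_; _∨_; if_then_else_)
open import Data.Rational as ℚ using (ℚ; 0ℚ; 1ℚ)
import Data.Integer as ℤ
open import Data.List using (List; []; _∷_; length; map; foldr)
open import Data.List.Relation.Unary.All using (All)
open import Data.Product using (Σ; _×_; _,_; proj₁; proj₂)
open import Data.Sum using (_⊎_)
open import Relation.Nullary using (¬_)
open import Relation.Binary.PropositionalEquality using (_≡_; _≢_)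
open import Function.Bundles using (_⇔_)

-- Total arithmetic helpers (denominators/moduli are always positive
-- where these are used; the value at 0 is an irrelevant convention).

frac : ℕ → ℕ → ℚ
frac a zero    = 0ℚ
frac a (suc b) = (ℤ.+ a) ℚ./ (suc b)

modN : ℕ → ℕ → ℕ
modN a zero    = a
modN a (suc m) = a ℕD.% suc m

divN : ℕ → ℕ → ℕ
divN a zero    = 0
divN a (suc m) = a ℕD./ suc m

sumQ : List ℚ → ℚ
sumQ = foldr ℚ._+_ 0ℚ

sumTo : ℕ → (ℕ → ℚ) → ℚ
sumTo zero    f = 0ℚ
sumTo (suc n) f = sumTo n f ℚ.+ f n

-- Search strategies on the path.  Every connected subgraph of the path
-- is an interval [a,b]; Strat a b is a search strategy for the
-- sub-path on vertex set [a,b].  An internal node is labelled by the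
-- edge {m, m+1} (a ≤ m < b); its subtrees are strategies for the
-- components [a,m] ∋ m and [m+1,b] ∋ m+1.

data Strat : ℕ → ℕ → Set where
  leaf : ∀ {a b} → Strat a b
  node : ∀ {a b} (m : ℕ) → a ≤ m → m < b → Strat a m → Strat (suc m) b → Strat a b

height : ∀ {a b} → Strat a b → ℕ
height leaf             = 0
height (node m _ _ l r) = suc (ℕ._⊔_ (height l) (height r))

covers : ∀ {a b} → Strat a b → ℕ → Bool
covers (leaf {a} {b}) u   = (a ≡ᵇ u) ∧ (b ≡ᵇ u)
covers (node m _ _ l r) u = covers l u ∨ covers r u

SG : ℕ → Set
SG n = Strat 0 (n ∸ 1)

Mixed : ℕ → Set
Mixed n = List (SG n × ℚ)

InΔ : ℕ → (n : ℕ) → Mixed n → Set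
InΔ k n x = All (λ p → height (proj₁ p) ≤ k × 0ℚ ℚ.≤ proj₂ p) x
            × sumQ (map proj₂ x) ≡ 1ℚ

coverProb : ∀ n → Mixed n → ℕ → ℚ
coverProb n x v = sumQ (map (λ p → if covers (proj₁ p) v then proj₂ p else 0ℚ) x)

-- hider strategy y ∈ Δ_V (values outside V are irrelevant)
InΔV : ℕ → (ℕ → ℚ) → Set
InΔV n y = (∀ v → v < n → 0ℚ ℚ.≤ y v) × sumTo n y ≡ 1ℚ

massCov : ∀ n → SG n → (ℕ → ℚ) → ℚ
massCov n T y = sumTo n (λ v → if covers T v then y v else 0ℚ)

payoff : ∀ n → Mixed n → (ℕ → ℚ) → ℚ
payoff n x y = sumQ (map (λ p → proj₂ p ℚ.* massCov n (proj₁ p) y) x)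

IsValue : ℕ → ℕ → ℚ → Set
IsValue k n val =
  (Σ (Mixed n) λ x → InΔ k n x × (∀ v → v < n → val ℚ.≤ coverProb n x v))
  × (∀ (x : Mixed n) → InΔ k n x → Σ ℕ λ v → v < n × coverProb n x v ℚ.≤ val)

SeekerOptimal : ℕ → (n : ℕ) → ℚ → Mixed n → Set
SeekerOptimal k n val x = InΔ k n x × (∀ v → v < n → val ℚ.≤ coverProb n x v)

HiderOptimal : ℕ → (n : ℕ) → ℚ → (ℕ → ℚ) → Set
HiderOptimal k n val y = InΔV n y × (∀ (x : Mixed n) → InΔ k n x → payoff n x y ℚ.≤ val)

Nash : ℕ → (n : ℕ) → Mixed n → (ℕ → ℚ) → Set
Nash k n x y = InΔ k n x × InΔV n y
  × (∀ (x' : Mixed n) → InΔ k n x' → payoff n x' y ℚ.≤ payoff n x y)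
  × (∀ (y' : ℕ → ℚ) → InΔV n y' → payoff n x y ℚ.≤ payoff n x y')

cOf : ℕ → ℕ
cOf k = 2 ^ k ∸ 2

HW : ℕ → ℕ → ℕ → ℕ → Set
HW c n h w = 0 < h × 0 < w × w ≤ n ∸ 2
  × (gcd c (n ∸ 1) ≡ 1 → h * (n ∸ 1) ≡ w * c + 1)
  × (gcd c (n ∸ 1) ≢ 1 → h * (n ∸ 1) ≡ w * c)

MinHW : ℕ → ℕ → ℕ → ℕ → Set
MinHW c n h w = HW c n h w × (∀ h' w' → HW c n h' w' → w ≤ w')

InCyc : ℕ → ℕ → ℕ → ℕ → Set
InCyc n v ℓ u = Σ ℕ λ j → j < ℓ × modN (v + j) n ≡ u

HitsEnd : ℕ → ℕ → ℕ → Set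
HitsEnd n c v = Σ ℕ λ u → (u ≡ 0 ⊎ u ≡ n ∸ 1) × InCyc n v (suc c) u

Efficient : ℕ → (n : ℕ) → ℕ → (ℕ → SG n) → Set
Efficient k n c T = ∀ v → v < n → v ≢ 1 →
  height (T v) ≤ k
  × (HitsEnd n c v → ∀ u → u < n → (covers (T v) u ≡ true ⇔ InCyc n v (suc c) u))
  × (¬ HitsEnd n c v → ∀ u → u < n → (covers (T v) u ≡ true ⇔ InCyc n v c u))

-- Greedy algorithm for the seeker.  The loop runs with fuel n, which
-- exceeds the number of iterations (the orbit of c+1 under +c mod n-1
-- reaches 1 after at most n-1 steps).

greedyLoop : ℕ → ℕ → ℕ → ℕ → List ℕ
greedyLoop c n zero    v = []
greedyLoop c n (suc f) v =
  if (v ≡ᵇ 0) ∨ (v ≡ᵇ 1) then [] else v ∷ greedyLoop c n f (modN (v + c) (n ∸ 1))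

greedyVerts : ℕ → ℕ → List ℕ
greedyVerts c n = 0 ∷ greedyLoop c n n (suc c)

greedyX : (n : ℕ) → ℕ → (ℕ → SG n) → Mixed n
greedyX n c T = map (λ v → (T v , frac 1 (length (greedyVerts c n)))) (greedyVerts c n)

yDiv : ℕ → ℕ → ℕ → ℚ
yDiv d w v = if modN v d ≡ᵇ 0 then 0ℚ else frac 1 (w * (d ∸ 1))

-- Segment construction for the hider (gcd(c, n-1) = 1).
-- segY c n h w i is the value y_i.  The state is the current start v
-- and the mass acc = y([1, v-1]) assigned so far; fuel n suffices.

segY : ℕ → ℕ → ℕ → ℕ → ℕ → ℚ
segY c n h w i = go n 1 0ℚ
  where
  r : ℕ
  r = divN c h
  g : ℕ → ℚ
  g v = frac (v * h) (w * c)
  go : ℕ → ℕ → ℚ → ℚ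
  go zero    v acc = 0ℚ
  go (suc f) v acc =
    if (n ∸ 2) <ᵇ v then 0ℚ else
      (let r* = if g (v + r) ℚ.≤ᵇ (acc ℚ.+ frac 1 w) then suc r else r in
       if (v ≤ᵇ i) ∧ (i <ᵇ v + r*) then frac 1 (r* * w)
       else go f (v + r*) (acc ℚ.+ frac 1 w))

-- Write N = n − 1.  Seeker: identify the vertices 0 and N, so that the greedy
-- strategies tile w consecutive windows of length c around a circle of length
-- N.  A vertex is hit by the j-th window as soon as some floor function
-- p ↦ ⌊(p + a)/N⌋ jumps between p = j c and p = (j + 1) c, and these jumps
-- telescope to ⌊(w c + a)/N⌋ ≥ h.
--
-- Hider: let Z(x) be the (scaled) mass of {1, …, x}.  In both constructions
--   Z(x + a) ≤ Z(x) + Z(a)   and   Z(x) + Z(a) ≤ Z(x + a + 1).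
-- The first bounds the mass of a block of length ℓ by Z(ℓ); the second merges
-- two blocks separated by one uncovered leaf.  Counting leaves, a strategy of
-- height k covers blocks which merge to a single one of length c, so its mass
-- is at most Z(c).  For the segment construction, Z is the inverse of the
-- piecewise linear interpolation E of j ↦ ⌊j c/h⌋, and the two inequalities are
-- dual to E(s) + E(t) ≤ E(s + t) ≤ E(s) + E(t) + 1, which E inherits from
-- the floor function.
module Submission where

open import Defs
open import Data.Nat using (ℕ; _≤_; _<_; _^_; _∸_)
open import Data.Nat.GCD using (gcd)
open import Data.Product using (_×_)
open import Relation.Binary.PropositionalEquality using (_≡_)

open import Data.Bool using (Bool; true; false; _∧_; _∨_; if_then_else_; T)
import Data.Integer as ℤ
import Data.Integer.Properties as ℤ
import Data.Integer.Tactic.RingSolver as ℤ-Solver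
open import Data.List using (List; []; _∷_; length; map)
open import Data.List.Relation.Unary.All using (All; []; _∷_)
open import Data.Nat as ℕ using (zero; suc; _+_; _*_; _⊔_; _⊓_; _≡ᵇ_; _≤ᵇ_; _<ᵇ_; z≤n; s≤s; NonZero)
open import Data.Nat.Coprimality using (coprime-divisor; coprime-/gcd; gcd≡1⇒coprime) renaming (sym to coprime-sym)
open import Data.Nat.DivMod
open import Data.Nat.Divisibility using (_∣_; divides; ∣⇒≤; ∣1⇒≡1; ∣m+n∣m⇒∣n; ∣-trans; n∣m*n)
open import Data.Nat.GCD using (gcd[m,n]∣m; gcd[m,n]∣n; gcd[m,n]≡0⇒n≡0)
import Data.Nat.Properties as ℕ
open import Data.Nat.Tactic.RingSolver using (solve-∀)
open import Data.Product using (Σ; _,_; proj₁; proj₂)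
open import Data.Rational as ℚ using (ℚ; 0ℚ; 1ℚ)
import Data.Rational.Properties as ℚ
open import Data.Rational.Unnormalised as ℚᵘ using (mkℚᵘ; *≡*; *≤*)
import Data.Rational.Unnormalised.Properties as ℚᵘ
open import Data.Sum using (_⊎_; inj₁; inj₂)
open import Data.Unit using (tt)
open import Function using (it)
open import Function.Bundles using (Equivalence)
open import Relation.Binary.PropositionalEquality using (_≢_; refl; sym; trans; cong; cong₂; subst; subst₂; module ≡-Reasoning)
open import Relation.Nullary using (Dec; yes; no; contradiction)

-- Arithmetic of the fractions `frac a b`.

toℚᵘ-frac : ∀ a b → ℚ.toℚᵘ (frac a (suc b)) ℚᵘ.≃ mkℚᵘ (ℤ.+ a) b
toℚᵘ-frac a b = ℚ.toℚᵘ-fromℚᵘ (mkℚᵘ (ℤ.+ a) b)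

frac-≡ : ∀ {a b c d} .{{_ : NonZero b}} .{{_ : NonZero d}} → a * d ≡ c * b → frac a b ≡ frac c d
frac-≡ {a} {suc b} {c} {suc d} eq = ℚ.toℚᵘ-injective
  (ℚᵘ.≃-trans (toℚᵘ-frac a b) (ℚᵘ.≃-trans (*≡* lemma) (ℚᵘ.≃-sym (toℚᵘ-frac c d))))
  where
  lemma : ℤ.+ a ℤ.* ℤ.+ suc d ≡ ℤ.+ c ℤ.* ℤ.+ suc b
  lemma = trans (sym (ℤ.pos-* a (suc d))) (trans (cong ℤ.+_ eq) (ℤ.pos-* c (suc b)))

frac-+ : ∀ a b d → frac a d ℚ.+ frac b d ≡ frac (a + b) d
frac-+ a b zero    = refl
frac-+ a b (suc d) = ℚ.toℚᵘ-injective
  (ℚᵘ.≃-trans (ℚ.toℚᵘ-homo-+ (frac a (suc d)) (frac b (suc d)))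
  (ℚᵘ.≃-trans (ℚᵘ.+-cong (toℚᵘ-frac a d) (toℚᵘ-frac b d))
  (ℚᵘ.≃-trans (*≡* (distrib (ℤ.+ a) (ℤ.+ b) (ℤ.+ suc d)))
              (ℚᵘ.≃-sym (toℚᵘ-frac (a + b) d)))))
  where
  distrib : ∀ x y z → (x ℤ.* z ℤ.+ y ℤ.* z) ℤ.* z ≡ (x ℤ.+ y) ℤ.* (z ℤ.* z)
  distrib = ℤ-Solver.solve-∀

frac-mono-≤ : ∀ {a b c d} .{{_ : NonZero b}} .{{_ : NonZero d}} → a * d ≤ c * b → frac a b ℚ.≤ frac c d
frac-mono-≤ {a} {suc b} {c} {suc d} le = ℚ.toℚᵘ-cancel-≤
  (ℚᵘ.≤-respˡ-≃ (ℚᵘ.≃-sym (toℚᵘ-frac a b)) (ℚᵘ.≤-respʳ-≃ (ℚᵘ.≃-sym (toℚᵘ-frac c d))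
    (*≤* (subst₂ ℤ._≤_ (ℤ.pos-* a (suc d)) (ℤ.pos-* c (suc b)) (ℤ.+≤+ le)))))

frac-cancel-≤ : ∀ {a b c d} .{{_ : NonZero b}} .{{_ : NonZero d}} → frac a b ℚ.≤ frac c d → a * d ≤ c * b
frac-cancel-≤ {a} {suc b} {c} {suc d} le
  with ℚᵘ.≤-respˡ-≃ (toℚᵘ-frac a b) (ℚᵘ.≤-respʳ-≃ (toℚᵘ-frac c d) (ℚ.toℚᵘ-mono-≤ le))
... | *≤* p = ℤ.drop‿+≤+ (subst₂ ℤ._≤_ (sym (ℤ.pos-* a (suc d))) (sym (ℤ.pos-* c (suc b))) p)

frac-0 : ∀ d → frac 0 d ≡ 0ℚ
frac-0 zero    = refl
frac-0 (suc d) = frac-≡ {0} {suc d} {0} {1} refl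

frac-1 : ∀ d .{{_ : NonZero d}} → frac d d ≡ 1ℚ
frac-1 d = frac-≡ {d} {d} {1} {1} (ℕ.*-comm d 1)

frac-nonneg : ∀ a d → 0ℚ ℚ.≤ frac a d
frac-nonneg a zero    = ℚ.≤-refl
frac-nonneg a (suc d) = frac-mono-≤ {0} {1} {a} {suc d} z≤n

-- Bilinearity of the payoff and weak duality.

sumTo-cong : ∀ n {f g} → (∀ v → v < n → f v ≡ g v) → sumTo n f ≡ sumTo n g
sumTo-cong zero    eq = refl
sumTo-cong (suc n) eq = cong₂ ℚ._+_ (sumTo-cong n (λ v v<n → eq v (ℕ.m<n⇒m<1+n v<n))) (eq n ℕ.≤-refl)

sumTo-mono : ∀ n {f g} → (∀ v → v < n → f v ℚ.≤ g v) → sumTo n f ℚ.≤ sumTo n g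
sumTo-mono zero    le = ℚ.≤-refl
sumTo-mono (suc n) le = ℚ.+-mono-≤ (sumTo-mono n (λ v v<n → le v (ℕ.m<n⇒m<1+n v<n))) (le n ℕ.≤-refl)

+-interchange : ∀ a b c d → (a ℚ.+ b) ℚ.+ (c ℚ.+ d) ≡ (a ℚ.+ c) ℚ.+ (b ℚ.+ d)
+-interchange a b c d = begin
  (a ℚ.+ b) ℚ.+ (c ℚ.+ d)  ≡⟨ ℚ.+-assoc a b (c ℚ.+ d) ⟩
  a ℚ.+ (b ℚ.+ (c ℚ.+ d))  ≡⟨ cong (a ℚ.+_) (sym (ℚ.+-assoc b c d)) ⟩
  a ℚ.+ ((b ℚ.+ c) ℚ.+ d)  ≡⟨ cong (λ z → a ℚ.+ (z ℚ.+ d)) (ℚ.+-comm b c) ⟩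
  a ℚ.+ ((c ℚ.+ b) ℚ.+ d)  ≡⟨ cong (a ℚ.+_) (ℚ.+-assoc c b d) ⟩
  a ℚ.+ (c ℚ.+ (b ℚ.+ d))  ≡⟨ ℚ.+-assoc a c (b ℚ.+ d) ⟨
  (a ℚ.+ c) ℚ.+ (b ℚ.+ d)  ∎
  where open ≡-Reasoning

sumTo-+ : ∀ n f g → sumTo n (λ v → f v ℚ.+ g v) ≡ sumTo n f ℚ.+ sumTo n g
sumTo-+ zero    f g = refl
sumTo-+ (suc n) f g = trans (cong (ℚ._+ (f n ℚ.+ g n)) (sumTo-+ n f g)) (+-interchange (sumTo n f) (sumTo n g) (f n) (g n))

sumTo-*ˡ : ∀ n q f → sumTo n (λ v → q ℚ.* f v) ≡ q ℚ.* sumTo n f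
sumTo-*ˡ zero    q f = sym (ℚ.*-zeroʳ q)
sumTo-*ˡ (suc n) q f = trans (cong (ℚ._+ (q ℚ.* f n)) (sumTo-*ˡ n q f)) (sym (ℚ.*-distribˡ-+ q (sumTo n f) (f n)))

*-monoˡ-≤-≥0 : ∀ q → 0ℚ ℚ.≤ q → ∀ {a b} → a ℚ.≤ b → q ℚ.* a ℚ.≤ q ℚ.* b
*-monoˡ-≤-≥0 q 0≤q = ℚ.*-monoˡ-≤-nonNeg q {{ℚ.nonNegative 0≤q}}

-- Exchange of the two sums: `payoff` has the strategies outermost, whereas the seeker's guarantee
-- is given vertex by vertex.
payoff-hider : ∀ n x y → payoff n x y ≡ sumTo n (λ v → y v ℚ.* coverProb n x v)
payoff-hider n []            y = begin
  0ℚ                            ≡⟨ ℚ.*-zeroˡ (sumTo n y) ⟨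
  0ℚ ℚ.* sumTo n y              ≡⟨ sumTo-*ˡ n 0ℚ y ⟨
  sumTo n (λ v → 0ℚ ℚ.* y v)    ≡⟨ sumTo-cong n (λ v _ → ℚ.*-comm 0ℚ (y v)) ⟩
  sumTo n (λ v → y v ℚ.* 0ℚ)    ∎
  where open ≡-Reasoning
payoff-hider n ((T , q) ∷ x) y = begin
  q ℚ.* massCov n T y ℚ.+ payoff n x y
    ≡⟨ cong₂ ℚ._+_ (sym (sumTo-*ˡ n q _)) (payoff-hider n x y) ⟩
  sumTo n (λ v → q ℚ.* (if covers T v then y v else 0ℚ)) ℚ.+ sumTo n (λ v → y v ℚ.* coverProb n x v)
    ≡⟨ sumTo-+ n _ _ ⟨
  sumTo n (λ v → q ℚ.* (if covers T v then y v else 0ℚ) ℚ.+ y v ℚ.* coverProb n x v)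
    ≡⟨ sumTo-cong n (λ v _ → pointwise v (covers T v)) ⟩
  sumTo n (λ v → y v ℚ.* ((if covers T v then q else 0ℚ) ℚ.+ coverProb n x v)) ∎
  where
  open ≡-Reasoning
  pointwise : ∀ v b → q ℚ.* (if b then y v else 0ℚ) ℚ.+ y v ℚ.* coverProb n x v
                    ≡ y v ℚ.* ((if b then q else 0ℚ) ℚ.+ coverProb n x v)
  pointwise v true  = trans (cong (ℚ._+ y v ℚ.* coverProb n x v) (ℚ.*-comm q (y v))) (sym (ℚ.*-distribˡ-+ (y v) q _))
  pointwise v false = trans (cong (ℚ._+ y v ℚ.* coverProb n x v) (trans (ℚ.*-zeroʳ q) (sym (ℚ.*-zeroʳ (y v))))) (sym (ℚ.*-distribˡ-+ (y v) 0ℚ _))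

payoff-≥ : ∀ n {val} x y → (∀ v → v < n → val ℚ.≤ coverProb n x v) → InΔV n y → val ℚ.≤ payoff n x y
payoff-≥ n {val} x y cov (y≥0 , Σy≡1) = begin
  val                                     ≡⟨ ℚ.*-identityʳ val ⟨
  val ℚ.* 1ℚ                              ≡⟨ cong (val ℚ.*_) Σy≡1 ⟨
  val ℚ.* sumTo n y                       ≡⟨ sumTo-*ˡ n val y ⟨
  sumTo n (λ v → val ℚ.* y v)             ≡⟨ sumTo-cong n (λ v _ → ℚ.*-comm val (y v)) ⟩
  sumTo n (λ v → y v ℚ.* val)             ≤⟨ sumTo-mono n (λ v v<n → *-monoˡ-≤-≥0 (y v) (y≥0 v v<n) (cov v v<n)) ⟩
  sumTo n (λ v → y v ℚ.* coverProb n x v) ≡⟨ payoff-hider n x y ⟨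
  payoff n x y                            ∎
  where open ℚ.≤-Reasoning

payoff-≤ : ∀ k n {val} x y → (∀ T → height T ≤ k → massCov n T y ℚ.≤ val) → InΔ k n x → payoff n x y ℚ.≤ val
payoff-≤ k n {val} x y mass (ok , Σx≡1) = begin
  payoff n x y                  ≤⟨ go x ok ⟩
  sumQ (map proj₂ x) ℚ.* val    ≡⟨ cong (ℚ._* val) Σx≡1 ⟩
  1ℚ ℚ.* val                    ≡⟨ ℚ.*-identityˡ val ⟩
  val                           ∎
  where
  open ℚ.≤-Reasoning
  go : ∀ x → All (λ p → height (proj₁ p) ≤ k × 0ℚ ℚ.≤ proj₂ p) x → payoff n x y ℚ.≤ sumQ (map proj₂ x) ℚ.* val
  go []            []                = ℚ.≤-reflexive (sym (ℚ.*-zeroˡ val))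
  go ((T , q) ∷ x) ((h≤k , 0≤q) ∷ a) = begin
    q ℚ.* massCov n T y ℚ.+ payoff n x y         ≤⟨ ℚ.+-mono-≤ (*-monoˡ-≤-≥0 q 0≤q (mass T h≤k)) (go x a) ⟩
    q ℚ.* val ℚ.+ sumQ (map proj₂ x) ℚ.* val     ≡⟨ ℚ.*-distribʳ-+ val q _ ⟨
    (q ℚ.+ sumQ (map proj₂ x)) ℚ.* val           ∎

argmin : ∀ n (f : ℕ → ℚ) → Σ ℕ λ v → v < suc n × (∀ u → u < suc n → f v ℚ.≤ f u)
argmin zero    f = 0 , s≤s z≤n , λ { zero _ → ℚ.≤-refl ; (suc u) (s≤s ()) }
argmin (suc n) f with argmin n f
... | v , v<n , min with ℚ.≤-total (f v) (f (suc n))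
...   | inj₁ le = v , ℕ.m<n⇒m<1+n v<n , λ u u<n → case u (ℕ.m≤n⇒m<n∨m≡n (ℕ.≤-pred u<n))
  where
  case : ∀ u → u < suc n ⊎ u ≡ suc n → f v ℚ.≤ f u
  case u (inj₁ u<) = min u u<
  case u (inj₂ refl) = le
...   | inj₂ ge = suc n , ℕ.≤-refl , λ u u<n → case u (ℕ.m≤n⇒m<n∨m≡n (ℕ.≤-pred u<n))
  where
  case : ∀ u → u < suc n ⊎ u ≡ suc n → f (suc n) ℚ.≤ f u
  case u (inj₁ u<) = ℚ.≤-trans ge (min u u<)
  case u (inj₂ refl) = ℚ.≤-refl

-- The mass is bounded on pure strategies, so the analysis of the hider concerns one tree at a time;
-- `payoff-≤` passes to mixtures.
HiderGuarantee : ℕ → (n : ℕ) → ℚ → (ℕ → ℚ) → Set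
HiderGuarantee k n val y = InΔV n y × (∀ T → height T ≤ k → massCov n T y ℚ.≤ val)

-- A vertex of minimal cover probability works: the minimum is at most the average under `y`, which
-- is the payoff, hence at most `val`.
uncovered : ∀ k n .{{_ : NonZero n}} {val} y → HiderGuarantee k n val y →
  ∀ x → InΔ k n x → Σ ℕ λ v → v < n × coverProb n x v ℚ.≤ val
uncovered k (suc n) {val} y (y∈Δ , mass) x x∈Δ with argmin n (coverProb (suc n) x)
... | v , v<n , min = v , v<n ,
  ℚ.≤-trans (payoff-≥ (suc n) x y min y∈Δ) (payoff-≤ k (suc n) x y mass x∈Δ)

-- Deviations of either player are compared through the common bound `val`, which `payoff n x y`
-- meets from both sides.
hider-optimal×nash : ∀ k n {val} x y → SeekerOptimal k n val x → HiderGuarantee k n val y →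
  HiderOptimal k n val y × Nash k n x y
hider-optimal×nash k n {val} x y (x∈Δ , cov) (y∈Δ , mass) =
  (y∈Δ , upper) ,
  x∈Δ , y∈Δ ,
  (λ x′ x′∈Δ → ℚ.≤-trans (upper x′ x′∈Δ) (lower y y∈Δ)) ,
  (λ y′ y′∈Δ → ℚ.≤-trans (upper x x∈Δ) (lower y′ y′∈Δ))
  where
  upper : ∀ x′ → InΔ k n x′ → payoff n x′ y ℚ.≤ val
  upper x′ = payoff-≤ k n x′ y mass
  lower : ∀ y′ → InΔV n y′ → val ℚ.≤ payoff n x y′
  lower y′ = payoff-≥ n x y′ cov

-- Integer weights of the covered set.

sumℕ : ℕ → (ℕ → ℕ) → ℕ
sumℕ zero    f = 0
sumℕ (suc n) f = sumℕ n f + f n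

sumTo-frac : ∀ n d {y} f → (∀ v → v < n → y v ≡ frac (f v) d) → sumTo n y ≡ frac (sumℕ n f) d
sumTo-frac zero    d f eq = sym (frac-0 d)
sumTo-frac (suc n) d f eq = trans
  (cong₂ ℚ._+_ (sumTo-frac n d f (λ v v<n → eq v (ℕ.m<n⇒m<1+n v<n))) (eq n ℕ.≤-refl))
  (frac-+ (sumℕ n f) (f n) d)

sumℕ-+-≤ : ∀ n {f g h} → (∀ v → f v ≤ g v + h v) → sumℕ n f ≤ sumℕ n g + sumℕ n h
sumℕ-+-≤ zero    le = z≤n
sumℕ-+-≤ (suc n) {f} {g} {h} le = ℕ.≤-trans (ℕ.+-mono-≤ (sumℕ-+-≤ n le) (le n))
  (ℕ.≤-reflexive (interchange (sumℕ n g) (sumℕ n h) (g n) (h n)))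
  where
  interchange : ∀ a b c d → (a + b) + (c + d) ≡ (a + c) + (b + d)
  interchange = solve-∀

sumℕ-zero : ∀ n {f} → (∀ v → v < n → f v ≡ 0) → sumℕ n f ≡ 0
sumℕ-zero zero    eq = refl
sumℕ-zero (suc n) eq = cong₂ _+_ (sumℕ-zero n (λ v v<n → eq v (ℕ.m<n⇒m<1+n v<n))) (eq n ℕ.≤-refl)

sumℕ-single : ∀ n a {f} → (∀ v → v ≢ a → f v ≡ 0) → sumℕ n f ≤ f a
sumℕ-single zero    a eq = z≤n
sumℕ-single (suc n) a {f} eq with n ℕ.≟ a
... | yes refl = ℕ.≤-reflexive (cong (_+ f n) (sumℕ-zero n (λ v v<n → eq v (ℕ.<⇒≢ v<n))))
... | no n≢a   = subst (_≤ f a) (sym (trans (cong (sumℕ n f +_) (eq n n≢a)) (ℕ.+-identityʳ _))) (sumℕ-single n a eq)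

≡ᵇ-true : ∀ {m n} → (m ≡ᵇ n) ≡ true → m ≡ n
≡ᵇ-true {m} {n} eq = ℕ.≡ᵇ⇒≡ m n (subst T (sym eq) tt)

-- Weights are the masses scaled by a common denominator, so that a single strategy is analysed in
-- `ℕ`.
coveredWeight : ∀ {a b} → (ℕ → ℕ) → ℕ → Strat a b → ℕ
coveredWeight wt n S = sumℕ n (λ v → if covers S v then wt v else 0)

coveredWeight-leaf : ∀ wt n a → coveredWeight wt n (leaf {a} {a}) ≤ wt a
coveredWeight-leaf wt n a = ℕ.≤-trans (sumℕ-single n a off) on
  where
  off : ∀ v → v ≢ a → (if covers (leaf {a} {a}) v then wt v else 0) ≡ 0
  off v v≢a with a ≡ᵇ v in eq
  ... | true  = contradiction (sym (≡ᵇ-true eq)) v≢a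
  ... | false = refl
  on : (if covers (leaf {a} {a}) a then wt a else 0) ≤ wt a
  on with covers (leaf {a} {a}) a
  ... | true  = ℕ.≤-refl
  ... | false = z≤n

coveredWeight-leaf-≢ : ∀ wt n {a b} → a ≢ b → coveredWeight wt n (leaf {a} {b}) ≡ 0
coveredWeight-leaf-≢ wt n {a} {b} a≢b = sumℕ-zero n λ v _ → off v
  where
  off : ∀ v → (if covers (leaf {a} {b}) v then wt v else 0) ≡ 0
  off v with a ≡ᵇ v in eq₁ | b ≡ᵇ v in eq₂
  ... | true  | true  = contradiction (trans (≡ᵇ-true eq₁) (sym (≡ᵇ-true eq₂))) a≢b
  ... | true  | false = refl
  ... | false | _     = refl

coveredWeight-node : ∀ wt n {a b} m (a≤m : a ≤ m) (m<b : m < b) l r →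
  coveredWeight wt n (node m a≤m m<b l r) ≤ coveredWeight wt n l + coveredWeight wt n r
coveredWeight-node wt n m _ _ l r = sumℕ-+-≤ n λ v → union (covers l v) (covers r v) (wt v)
  where
  union : ∀ b b′ x → (if b ∨ b′ then x else 0) ≤ (if b then x else 0) + (if b′ then x else 0)
  union true  b′ x = ℕ.m≤m+n x _
  union false b′ x = ℕ.≤-refl

2^-join : ∀ {x y} i j → x ≤ 2 ^ i → y ≤ 2 ^ j → x + y ≤ 2 ^ suc (i ⊔ j)
2^-join i j x≤ y≤ = ℕ.+-mono-≤
  (ℕ.≤-trans x≤ (ℕ.^-monoʳ-≤ 2 (ℕ.m≤m⊔n i j)))
  (ℕ.≤-trans y≤ (ℕ.≤-trans (ℕ.^-monoʳ-≤ 2 (ℕ.m≤n⊔m i j)) (ℕ.m≤m+n _ 0)))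

-- Mass bound for weights that are the increments of a profile `Z`.

module Profile
  (Z : ℕ → ℕ) (Z-zero : Z 0 ≡ 0)
  (Z-sub : ∀ x a → Z (x + a) ≤ Z x + Z a)
  (Z-sup : ∀ x a → Z x + Z a ≤ Z (suc (x + a)))
  (M : ℕ) (wt : ℕ → ℕ)
  (wt-first : wt 0 ≡ 0)
  (wt-step : ∀ v → v < M → wt (suc v) + Z v ≡ Z (suc v))
  (wt-last : wt (suc M) ≡ 0)
  where

  n : ℕ
  n = suc (suc M)

  -- `Z-sup` with `a = 0` is monotonicity for a single step.
  Z-mono : ∀ {x y} → x ≤ y → Z x ≤ Z y
  Z-mono {x} x≤y = subst (λ z → Z x ≤ Z z) (ℕ.m+[n∸m]≡n x≤y) (up (_ ∸ x))
    where
    up : ∀ t → Z x ≤ Z (x + t)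
    up zero    = ℕ.≤-reflexive (cong Z (sym (ℕ.+-identityʳ x)))
    up (suc t) = begin
      Z x              ≤⟨ up t ⟩
      Z (x + t)        ≤⟨ ℕ.m≤m+n _ (Z 0) ⟩
      Z (x + t) + Z 0  ≤⟨ Z-sup (x + t) 0 ⟩
      Z (suc (x + t + 0)) ≡⟨ cong Z (trans (cong suc (ℕ.+-identityʳ (x + t))) (sym (ℕ.+-suc x t))) ⟩
      Z (x + suc t)    ∎
      where open ℕ.≤-Reasoning

  -- A block of length ℓ weighs at most Z⁻ (ℓ + 1): the extra unit is the leaf
  -- that separates it from the next block, and makes Z⁻ superadditive.
  Z⁻ : ℕ → ℕ
  Z⁻ t = Z (t ∸ 1)

  Z⁻-super : ∀ s t → Z⁻ s + Z⁻ t ≤ Z⁻ (s + t)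
  Z⁻-super zero    t       = ℕ.≤-reflexive (cong (_+ Z⁻ t) Z-zero)
  Z⁻-super (suc s) zero    = ℕ.≤-reflexive (trans (cong (Z s +_) Z-zero) (trans (ℕ.+-identityʳ (Z s)) (cong Z (sym (ℕ.+-identityʳ s)))))
  Z⁻-super (suc s) (suc t) = subst (λ z → Z s + Z t ≤ Z z) (sym (ℕ.+-suc s t)) (Z-sup s t)

  -- Cumulative weight of {0, …, v − 1}; the truncations account for the
  -- massless end vertices 0 and M + 1.
  W : ℕ → ℕ
  W v = Z ((v ∸ 1) ⊓ M)

  W-step : ∀ a → a ≤ suc M → wt a + W a ≡ W (suc a)
  W-step zero    _ = cong (_+ W 0) wt-first
  W-step (suc v) v≤M with ℕ.m≤n⇒m<n∨m≡n (ℕ.≤-pred v≤M)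
  ... | inj₁ v<M  = begin
    wt (suc v) + Z (v ⊓ M) ≡⟨ cong (λ z → wt (suc v) + Z z) (ℕ.m≤n⇒m⊓n≡m (ℕ.<⇒≤ v<M)) ⟩
    wt (suc v) + Z v       ≡⟨ wt-step v v<M ⟩
    Z (suc v)              ≡⟨ cong Z (ℕ.m≤n⇒m⊓n≡m v<M) ⟨
    Z (suc v ⊓ M)          ∎
    where open ≡-Reasoning
  ... | inj₂ refl = begin
    wt (suc v) + Z (v ⊓ v) ≡⟨ cong (_+ Z (v ⊓ v)) wt-last ⟩
    Z (v ⊓ v)              ≡⟨ cong Z (trans (ℕ.⊓-idem v) (sym (ℕ.m≥n⇒m⊓n≡n (ℕ.n≤1+n v)))) ⟩
    Z (suc v ⊓ v)          ∎
    where open ≡-Reasoning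

  W-sum : ∀ v → v ≤ n → sumℕ v wt ≡ W v
  W-sum zero    _   = sym Z-zero
  W-sum (suc v) v<n = begin
    sumℕ v wt + wt v ≡⟨ cong (_+ wt v) (W-sum v (ℕ.<⇒≤ v<n)) ⟩
    W v + wt v       ≡⟨ ℕ.+-comm (W v) (wt v) ⟩
    wt v + W v       ≡⟨ W-step v (ℕ.≤-pred v<n) ⟩
    W (suc v)        ∎
    where open ≡-Reasoning

  total : sumℕ n wt ≡ Z M
  total = trans (W-sum n ℕ.≤-refl) (cong Z (ℕ.m≥n⇒m⊓n≡n (ℕ.n≤1+n M)))

  -- Truncation never widens the distance between the two arguments, so `Z-sub` applies after
  -- `Z-mono`.
  W-block : ∀ x ℓ → W (x + ℓ) ≤ W x + Z ℓ
  W-block x ℓ = ℕ.≤-trans (Z-mono bound) (Z-sub ((x ∸ 1) ⊓ M) ℓ)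
    where
    open ℕ.≤-Reasoning
    pred-+ : ∀ x → x + ℓ ∸ 1 ≤ (x ∸ 1) + ℓ
    pred-+ zero    = ℕ.m∸n≤m ℓ 1
    pred-+ (suc x) = ℕ.≤-refl
    bound : (x + ℓ ∸ 1) ⊓ M ≤ (x ∸ 1) ⊓ M + ℓ
    bound = begin
      (x + ℓ ∸ 1) ⊓ M         ≤⟨ ℕ.⊓-mono-≤ (pred-+ x) (ℕ.m≤m+n M ℓ) ⟩
      (x ∸ 1 + ℓ) ⊓ (M + ℓ)   ≡⟨ ℕ.+-distribʳ-⊓ ℓ (x ∸ 1) M ⟨
      (x ∸ 1) ⊓ M + ℓ         ∎

  -- The form `m + W x ≤ W (x + ℓ)`, used throughout, says without subtraction that `m` is at most
  -- the weight of the `ℓ` vertices from `x` on.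
  block-weight : ∀ x ℓ {m} → m + W x ≤ W (x + ℓ) → m ≤ Z ℓ
  block-weight x ℓ {m} le = ℕ.+-cancelʳ-≤ (W x) m (Z ℓ)
    (ℕ.≤-trans le (ℕ.≤-trans (W-block x ℓ) (ℕ.≤-reflexive (ℕ.+-comm (W x) (Z ℓ)))))

  append : ∀ x ℓ ℓ′ m m′ {y} → y ≡ x + ℓ → m + W x ≤ W (x + ℓ) → m′ + W y ≤ W (y + ℓ′) →
    m + m′ + W x ≤ W (x + (ℓ + ℓ′))
  append x ℓ ℓ′ m m′ refl p p′ = begin
    m + m′ + W x         ≡⟨ swap m m′ (W x) ⟩
    m′ + (m + W x)       ≤⟨ ℕ.+-monoʳ-≤ m′ p ⟩
    m′ + W (x + ℓ)       ≤⟨ p′ ⟩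
    W (x + ℓ + ℓ′)       ≡⟨ cong W (ℕ.+-assoc x ℓ ℓ′) ⟩
    W (x + (ℓ + ℓ′))     ∎
    where
    open ℕ.≤-Reasoning
    swap : ∀ a b c → a + b + c ≡ b + (a + c)
    swap = solve-∀

  -- Either every leaf is a singleton, or the leaves are p singletons on the
  -- left, q singletons on the right (starting at e), and in between uncovered
  -- leaves and blocks with t + 1 leaves in total.
  data Shape (a b i m : ℕ) : Set where
    full : ∀ ℓ → ℓ ≤ 2 ^ i → suc b ≡ a + ℓ → m + W a ≤ W (a + ℓ) → Shape a b i m
    gap  : ∀ p t e q m₁ m₂ m₃ → suc (p + t + q) ≤ 2 ^ i → m ≤ m₁ + m₂ + m₃ →
           m₁ + W a ≤ W (a + p) → m₂ ≤ Z⁻ t → e + q ≡ suc b → m₃ + W e ≤ W (e + q) →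
           Shape a b i m

  -- Leaf counts add up as in `2^-join`. The real work is in the last case: the `q` singletons
  -- ending the left side and the `p′` singletons starting the right side fuse into one inner block,
  -- and of the two `suc` in the counts one becomes the separator of this block.
  join : ∀ {a b c i j x y z} → Shape a b i x → Shape (suc b) c j y → z ≤ x + y → Shape a c (suc (i ⊔ j)) z
  join {a} {i = i} {j} {x} {y} (full ℓ ℓ≤ end w) (full ℓ′ ℓ′≤ end′ w′) z≤ =
    full (ℓ + ℓ′) (2^-join i j ℓ≤ ℓ′≤)
      (trans end′ (trans (cong (_+ ℓ′) end) (ℕ.+-assoc a ℓ ℓ′)))
      (ℕ.≤-trans (ℕ.+-monoˡ-≤ _ z≤)
        (append a ℓ ℓ′ x y end w w′))
  join {a} {i = i} {j} {x} {y} (full ℓ ℓ≤ end w) (gap p t e q m₁ m₂ m₃ count y≤ w₁ w₂ end′ w₃) z≤ =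
    gap (ℓ + p) t e q (x + m₁) m₂ m₃
      (ℕ.≤-trans (ℕ.≤-reflexive (sym (count-eq ℓ p t q))) (2^-join i j ℓ≤ count))
      (ℕ.≤-trans z≤ (ℕ.≤-trans (ℕ.+-monoʳ-≤ x y≤) (ℕ.≤-reflexive (mass-eq x m₁ m₂ m₃))))
      (append a ℓ p x m₁ end w w₁)
      w₂ end′ w₃
    where
    count-eq : ∀ ℓ p t q → ℓ + suc (p + t + q) ≡ suc (ℓ + p + t + q)
    count-eq = solve-∀
    mass-eq : ∀ x a b c → x + (a + b + c) ≡ x + a + b + c
    mass-eq = solve-∀
  join {a} {i = i} {j} {x} {y} (gap p t e q m₁ m₂ m₃ count x≤ w₁ w₂ end w₃) (full ℓ ℓ≤ end′ w) z≤ =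
    gap p t e (q + ℓ) m₁ m₂ (m₃ + y)
      (ℕ.≤-trans (ℕ.≤-reflexive (sym (count-eq ℓ p t q))) (2^-join i j count ℓ≤))
      (ℕ.≤-trans z≤ (ℕ.≤-trans (ℕ.+-monoˡ-≤ y x≤) (ℕ.≤-reflexive (mass-eq y m₁ m₂ m₃))))
      w₁ w₂
      (sym (trans end′ (trans (cong (_+ ℓ) (sym end)) (ℕ.+-assoc e q ℓ))))
      (append e q ℓ m₃ y (sym end) w₃ w)
    where
    count-eq : ∀ ℓ p t q → suc (p + t + q) + ℓ ≡ suc (p + t + (q + ℓ))
    count-eq = solve-∀
    mass-eq : ∀ y a b c → (a + b + c) + y ≡ a + b + (c + y)
    mass-eq = solve-∀
  join {a} {i = i} {j} {x} {y}
    (gap p t e q m₁ m₂ m₃ count x≤ w₁ w₂ end w₃) (gap p′ t′ e′ q′ m₁′ m₂′ m₃′ count′ y≤ w₁′ w₂′ end′ w₃′) z≤ =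
    gap p (t + suc (q + p′) + t′) e′ q′ m₁ (m₂ + (m₃ + m₁′) + m₂′) m₃′
      (ℕ.≤-trans (ℕ.≤-reflexive (sym (count-eq p t q p′ t′ q′))) (2^-join i j count count′))
      (ℕ.≤-trans z≤ (ℕ.≤-trans (ℕ.+-mono-≤ x≤ y≤) (ℕ.≤-reflexive (mass-eq m₁ m₂ m₃ m₁′ m₂′ m₃′))))
      w₁ middle end′ w₃′
    where
    count-eq : ∀ p t q p′ t′ q′ → suc (p + t + q) + suc (p′ + t′ + q′) ≡ suc (p + (t + suc (q + p′) + t′) + q′)
    count-eq = solve-∀
    mass-eq : ∀ a b c d e f → (a + b + c) + (d + e + f) ≡ a + (b + (c + d) + e) + f
    mass-eq = solve-∀
    merged : m₃ + m₁′ ≤ Z (q + p′)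
    merged = block-weight e (q + p′)
      (append e q p′ m₃ m₁′ (sym end) w₃ w₁′)
    middle : m₂ + (m₃ + m₁′) + m₂′ ≤ Z⁻ (t + suc (q + p′) + t′)
    middle = ℕ.≤-trans (ℕ.+-mono-≤ (ℕ.≤-trans (ℕ.+-mono-≤ w₂ merged) (Z⁻-super t (suc (q + p′)))) w₂′)
                       (Z⁻-super (t + suc (q + p′)) t′)

  shape : ∀ {a b} (S : Strat a b) → b ≤ suc M → Shape a b (height S) (coveredWeight wt n S)
  shape (leaf {a} {b}) b≤ with a ℕ.≟ b
  ... | yes refl = full 1 ℕ.≤-refl (ℕ.+-comm 1 a)
    (ℕ.≤-trans (ℕ.+-monoˡ-≤ _ (coveredWeight-leaf wt n a))
      (ℕ.≤-reflexive (trans (W-step a b≤) (cong W (ℕ.+-comm 1 a)))))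
  -- All blocks are empty, the right one starting just past `b`; the `suc` in the count is the
  -- uncovered leaf itself.
  ... | no a≢b   = gap 0 0 (suc b) 0 0 0 0 ℕ.≤-refl (ℕ.≤-reflexive (coveredWeight-leaf-≢ wt n a≢b))
    (ℕ.≤-reflexive (cong W (sym (ℕ.+-identityʳ a)))) z≤n (ℕ.+-identityʳ (suc b))
    (ℕ.≤-reflexive (cong W (sym (ℕ.+-identityʳ (suc b)))))
  shape (node m a≤m m<b l r) b≤ =
    join (shape l (ℕ.≤-trans (ℕ.<⇒≤ m<b) b≤)) (shape r b≤) (coveredWeight-node wt n m a≤m m<b l r)

  -- A nonempty block at the right end contains the massless vertex `M + 1`, which the truncation in
  -- `W` discards; hence `Z⁻` and not `Z`.
  suffix-weight : ∀ e q {m} → e + q ≡ n → m + W e ≤ W (e + q) → m ≤ Z⁻ q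
  suffix-weight zero    q {m} refl le = ℕ.≤-trans (ℕ.m≤m+n m _) (ℕ.≤-trans le (Z-mono (ℕ.m⊓n≤m _ M)))
  suffix-weight (suc e) zero {m} eq le = ℕ.+-cancelʳ-≤ (W (suc e)) m (Z 0)
    (ℕ.≤-trans le (ℕ.≤-trans (ℕ.≤-reflexive (cong W (ℕ.+-identityʳ (suc e)))) (ℕ.m≤n+m _ (Z 0))))
  suffix-weight (suc e) (suc q) {m} eq le = block-weight (suc e) q (ℕ.≤-trans le (ℕ.≤-reflexive (cong Z same)))
    where
    e+q≡M : e + q ≡ M
    e+q≡M = ℕ.suc-injective (trans (sym (ℕ.+-suc e q)) (ℕ.suc-injective eq))
    same : (e + suc q) ⊓ M ≡ (e + q) ⊓ M
    same = trans (ℕ.m≥n⇒m⊓n≡n (ℕ.≤-trans (ℕ.≤-reflexive (sym e+q≡M)) (ℕ.+-monoʳ-≤ e (ℕ.n≤1+n q))))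
                 (sym (ℕ.m≥n⇒m⊓n≡n (ℕ.≤-reflexive (sym e+q≡M))))

  -- With more than `2 ^ k` vertices not all leaves are singletons, so there is a gap. Both end
  -- blocks lose a massless end vertex, so all three parts are bounded by `Z⁻` and merge by
  -- `Z⁻-super`. From `2 ^ k = c + 2`, the `suc` in the count and the predecessor in `Z⁻` leave `c`.
  coveredWeight-≤ : ∀ {c k} → 2 ^ k ≡ suc (suc c) → 2 ^ k < n → (S : SG n) → height S ≤ k →
    coveredWeight wt n S ≤ Z c
  coveredWeight-≤ {c} {k} 2^k≡ 2^k<n S h≤k with shape S ℕ.≤-refl | ℕ.^-monoʳ-≤ 2 h≤k
  ... | full ℓ ℓ≤ end _ | 2^≤ =
    contradiction (ℕ.≤-trans (ℕ.≤-reflexive end) (ℕ.≤-trans ℓ≤ 2^≤)) (ℕ.<⇒≱ 2^k<n)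
  ... | gap p t e q m₁ m₂ m₃ count m≤ w₁ w₂ end w₃ | 2^≤ = begin
    coveredWeight wt n S  ≤⟨ m≤ ⟩
    m₁ + m₂ + m₃          ≤⟨ ℕ.+-mono-≤ (ℕ.+-mono-≤ prefix w₂) (suffix-weight e q end w₃) ⟩
    Z⁻ p + Z⁻ t + Z⁻ q    ≤⟨ ℕ.+-monoˡ-≤ (Z⁻ q) (Z⁻-super p t) ⟩
    Z⁻ (p + t) + Z⁻ q     ≤⟨ Z⁻-super (p + t) q ⟩
    Z⁻ (p + t + q)        ≤⟨ Z-mono (ℕ.∸-monoˡ-≤ 1 (ℕ.≤-pred (ℕ.≤-trans count (ℕ.≤-trans 2^≤ (ℕ.≤-reflexive 2^k≡))))) ⟩
    Z c                   ∎
    where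
    open ℕ.≤-Reasoning
    prefix : m₁ ≤ Z⁻ p
    prefix = ℕ.≤-trans (ℕ.m≤m+n m₁ _) (ℕ.≤-trans w₁ (Z-mono (ℕ.m⊓n≤m (p ∸ 1) M)))

  -- The equation on `Z c` is `Z c / Z M = h / w` cleared of denominators, `Z M` being the total
  -- weight.
  hiderGuarantee : ∀ {c k h w} y .{{_ : NonZero (Z M)}} .{{_ : NonZero w}} →
    2 ^ k ≡ suc (suc c) → 2 ^ k < n → Z c * w ≡ h * Z M →
    (∀ v → v < n → y v ≡ frac (wt v) (Z M)) → HiderGuarantee k n (frac h w) y
  hiderGuarantee {c} {k} {h} {w} y 2^k≡ 2^k<n value y≡ =
    ((λ v v<n → subst (0ℚ ℚ.≤_) (sym (y≡ v v<n)) (frac-nonneg (wt v) (Z M))) ,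
     trans (sumTo-frac n (Z M) wt y≡) (trans (cong (λ z → frac z (Z M)) total) (frac-1 (Z M)))) ,
    λ S h≤k → subst (ℚ._≤ frac h w)
      (sym (sumTo-frac n (Z M) (λ v → if covers S v then wt v else 0) λ v v<n → masked v (covers S v) v<n))
      (frac-mono-≤ {coveredWeight wt n S} {Z M} {h} {w}
        (ℕ.≤-trans (ℕ.*-monoˡ-≤ w (coveredWeight-≤ 2^k≡ 2^k<n S h≤k)) (ℕ.≤-reflexive value)))
    where
    masked : ∀ v b → v < n → (if b then y v else 0ℚ) ≡ frac (if b then wt v else 0) (Z M)
    masked v true  v<n = y≡ v v<n
    masked v false v<n = sym (frac-0 (Z M))

-- Floor inequalities.

*≤⇒≤/ : ∀ {a m} d .{{_ : NonZero d}} → a * d ≤ m → a ≤ m / d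
*≤⇒≤/ {a} {m} d le = subst (_≤ m / d) (m*n/n≡m a d) (/-monoˡ-≤ d le)

≤/⇒*≤ : ∀ {a m} d .{{_ : NonZero d}} → a ≤ m / d → a * d ≤ m
≤/⇒*≤ {a} {m} d le = ℕ.≤-trans (ℕ.*-monoˡ-≤ d le) (m/n*n≤m m d)

/-super : ∀ x y d .{{_ : NonZero d}} → x / d + y / d ≤ (x + y) / d
/-super x y d = *≤⇒≤/ d (ℕ.≤-trans (ℕ.≤-reflexive (ℕ.*-distribʳ-+ d (x / d) (y / d)))
  (ℕ.+-mono-≤ (m/n*n≤m x d) (m/n*n≤m y d)))

<*suc/ : ∀ x d .{{_ : NonZero d}} → x < suc (x / d) * d
<*suc/ x d = subst (_< suc (x / d) * d) (sym (m≡m%n+[m/n]*n x d)) (ℕ.+-monoˡ-< (x / d * d) (m%n<n x d))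

-- Integrality pays for the extra unit: `x` and `y` lie strictly below the next multiples of `d`, so
-- `x + y + 2` is at most the sum of these multiples.
/-sub : ∀ x y d .{{_ : NonZero d}} → suc (x + y) / d ≤ suc (x / d + y / d)
/-sub x y d = ℕ.≤-pred (m<n*o⇒m/o<n {o = d} (begin-strict
  suc (x + y)                          <⟨ ℕ.≤-refl ⟩
  suc (suc (x + y))                    ≡⟨ cong suc (ℕ.+-suc x y) ⟨
  suc x + suc y                        ≤⟨ ℕ.+-mono-≤ (<*suc/ x d) (<*suc/ y d) ⟩
  suc (x / d) * d + suc (y / d) * d    ≡⟨ ℕ.*-distribʳ-+ d (suc (x / d)) (suc (y / d)) ⟨
  (suc (x / d) + suc (y / d)) * d      ≡⟨ cong (_* d) (ℕ.+-suc (suc (x / d)) (y / d)) ⟩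
  suc (suc (x / d + y / d)) * d        ∎))
  where open ℕ.≤-Reasoning

[m+k*n]/n≡k : ∀ {m} k n .{{_ : NonZero n}} → m < n → (m + k * n) / n ≡ k
[m+k*n]/n≡k {m} k n m<n = trans (+-distrib-/-∣ʳ m (n∣m*n k)) (cong₂ _+_ (m<n⇒m/n≡0 m<n) (m*n/n≡m k n))

-- The segment profile `Z` and its inverse, the interpolation `E`.

module Segments (c h : ℕ) .{{_ : NonZero h}} (h≤c : h ≤ c) where

  -- The number of vertices in the first `j` segments: segment `j` runs from vertex `e j + 1` to
  -- vertex `e (suc j)`.
  e : ℕ → ℕ
  e j = j * c / h

  r : ℕ
  r = c / h

  e-zero : e 0 ≡ 0
  e-zero = 0/n≡0 h

  e-super : ∀ j l → e j + e l ≤ e (j + l)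
  e-super j l = subst (λ z → e j + e l ≤ z / h) (sym (ℕ.*-distribʳ-+ c j l)) (/-super (j * c) (l * c) h)

  e-sub : ∀ j l → e (j + l) ≤ suc (e j + e l)
  e-sub j l = ℕ.≤-trans
    (/-monoˡ-≤ h (ℕ.≤-trans (ℕ.≤-reflexive (ℕ.*-distribʳ-+ c j l)) (ℕ.n≤1+n _)))
    (/-sub (j * c) (l * c) h)

  e-suc-≥ : ∀ j → e j + r ≤ e (suc j)
  e-suc-≥ j = ℕ.≤-trans (/-super (j * c) c h) (ℕ.≤-reflexive (cong (_/ h) (ℕ.+-comm (j * c) c)))

  e-suc-≤ : ∀ j → e (suc j) ≤ suc (e j + r)
  e-suc-≤ j = ℕ.≤-trans (/-monoˡ-≤ h (ℕ.≤-trans (ℕ.≤-reflexive (ℕ.+-comm c (j * c))) (ℕ.n≤1+n _))) (/-sub (j * c) c h)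

  0<r : 0 < r
  0<r = m≥n⇒m/n>0 h≤c

  e-<-suc : ∀ j → e j < e (suc j)
  e-<-suc j = ℕ.≤-trans (ℕ.m<m+n (e j) 0<r) (e-suc-≥ j)

  e-mono : ∀ {i j} → i ≤ j → e i ≤ e j
  e-mono i≤j = /-monoˡ-≤ h (ℕ.*-monoˡ-≤ c i≤j)

  e-cancel-< : ∀ {i j} → e i < e j → i < j
  e-cancel-< lt = ℕ.≰⇒> λ j≤i → ℕ.<⇒≱ lt (e-mono j≤i)

  len : ℕ → ℕ
  len j = e (suc j) ∸ e j

  e-suc : ∀ j → e (suc j) ≡ e j + len j
  e-suc j = sym (ℕ.m+[n∸m]≡n (ℕ.<⇒≤ (e-<-suc j)))

  len-cases : ∀ j → len j ≡ r ⊎ len j ≡ suc r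
  len-cases j with ℕ.m≤n⇒m<n∨m≡n (ℕ.∸-monoˡ-≤ (e j) (e-suc-≤ j))
  ... | inj₂ eq = inj₂ (trans eq (trans (cong (_∸ e j) (sym (ℕ.+-suc (e j) r))) (ℕ.m+n∸m≡n (e j) (suc r))))
  ... | inj₁ lt = inj₁ (ℕ.≤-antisym
    (ℕ.≤-pred (subst (len j <_) (trans (cong (_∸ e j) (sym (ℕ.+-suc (e j) r))) (ℕ.m+n∸m≡n (e j) (suc r))) lt))
    (subst (_≤ len j) (ℕ.m+n∸m≡n (e j) r) (ℕ.∸-monoˡ-≤ (e j) (e-suc-≥ j))))

  0<len : ∀ j → 0 < len j
  0<len j = ℕ.m<n⇒0<n∸m (e-<-suc j)

  -- Common denominator of the masses 1/(r w) and 1/((r + 1) w), up to w.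
  R : ℕ
  R = r * suc r

  instance
    R-nonZero : NonZero R
    R-nonZero = ℕ.>-nonZero (ℕ.*-mono-≤ 0<r (s≤s z≤n))

  -- R divided by the length of the j-th segment.
  ρ : ℕ → ℕ
  ρ j = suc (r + r) ∸ len j

  len*ρ : ∀ j → len j * ρ j ≡ R
  len*ρ j with len-cases j
  ... | inj₁ eq rewrite eq = cong (r *_) (trans (cong (_∸ r) (sym (ℕ.+-suc r r))) (ℕ.m+n∸m≡n r (suc r)))
  ... | inj₂ eq rewrite eq = trans (cong (suc r *_) (ℕ.m+n∸m≡n r r)) (ℕ.*-comm (suc r) r)

  -- Positions count from 0: position `x` stands for vertex `x + 1`.
  record Position (x : ℕ) : Set where
    constructor pos
    field
      seg    : ℕ
      off    : ℕ
      split  : x ≡ e seg + off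
      inside : off < len seg

  open Position

  locate : ∀ x → Position x
  locate zero = pos 0 0 (sym (trans (ℕ.+-identityʳ (e 0)) e-zero)) (0<len 0)
  locate (suc x) with locate x
  ... | pos j i eq i<len with suc i ℕ.<? len j
  ...   | yes 1+i<len = pos j (suc i) (trans (cong suc eq) (sym (ℕ.+-suc (e j) i))) 1+i<len
  ...   | no  1+i≮len = pos (suc j) 0
    (trans (cong suc eq) (trans (sym (ℕ.+-suc (e j) i))
      (trans (cong (e j +_) (ℕ.≤-antisym i<len (ℕ.≮⇒≥ 1+i≮len))) (trans (sym (e-suc j)) (sym (ℕ.+-identityʳ _))))))
    (0<len (suc j))

  -- Each full segment weighs `R`, spread evenly, so a vertex of segment `j` weighs `ρ j`. This
  -- scales the masses by `w * R`.
  Z : ℕ → ℕ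
  Z x = off (locate x) * ρ (seg (locate x)) + seg (locate x) * R

  Z-zero : Z 0 ≡ 0
  Z-zero = refl

  -- The case split repeats the one in `locate`, so that `Z (suc x)` computes; leaving a segment
  -- completes its weight `R`.
  Z-step : ∀ x → ρ (seg (locate x)) + Z x ≡ Z (suc x)
  Z-step x with locate x
  ... | pos j i eq i<len with suc i ℕ.<? len j
  ...   | yes 1+i<len = sym (ℕ.+-assoc (ρ j) (i * ρ j) (j * R))
  ...   | no  1+i≮len = begin
    ρ j + (i * ρ j + j * R)   ≡⟨ ℕ.+-assoc (ρ j) (i * ρ j) (j * R) ⟨
    suc i * ρ j + j * R       ≡⟨ cong (λ z → z * ρ j + j * R) (ℕ.≤-antisym i<len (ℕ.≮⇒≥ 1+i≮len)) ⟩
    len j * ρ j + j * R       ≡⟨ cong (_+ j * R) (len*ρ j) ⟩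
    R + j * R                 ∎
    where open ≡-Reasoning

  -- R times the linear interpolation of e at s/R.
  E : ℕ → ℕ
  E s = (R ∸ s % R) * e (s / R) + s % R * e (suc (s / R))

  -- The fractional part of `s/R` is kept as two weights with sum `R`, which avoids truncated
  -- subtraction.
  data Rep (s : ℕ) : Set where
    rep : ∀ p α β → α + β ≡ R → s ≡ β + p * R → β < R → Rep s

  represent : ∀ s → Rep s
  represent s = rep (s / R) (R ∸ s % R) (s % R) (ℕ.m∸n+n≡m (ℕ.<⇒≤ (m%n<n s R))) (m≡m%n+[m/n]*n s R) (m%n<n s R)

  E-rep-< : ∀ p α β → α + β ≡ R → β < R → E (β + p * R) ≡ α * e p + β * e (suc p)
  E-rep-< p α β sum β<R = begin
    E (β + p * R)                          ≡⟨ cong₂ (λ q b → (R ∸ b) * e q + b * e (suc q)) ([m+k*n]/n≡k p R β<R)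
                                                (trans ([m+kn]%n≡m%n β p R) (m<n⇒m%n≡m β<R)) ⟩
    (R ∸ β) * e p + β * e (suc p)          ≡⟨ cong (λ z → (z ∸ β) * e p + β * e (suc p)) sum ⟨
    (α + β ∸ β) * e p + β * e (suc p)      ≡⟨ cong (λ z → z * e p + β * e (suc p)) (ℕ.m+n∸n≡m α β) ⟩
    α * e p + β * e (suc p)                ∎
    where open ≡-Reasoning

  -- Neighbouring linear pieces agree at breakpoints, so `β = R` is admissible too. `E-suc` and the
  -- borderline case of `additive` rely on this.
  E-rep : ∀ p α β → α + β ≡ R → E (β + p * R) ≡ α * e p + β * e (suc p)
  E-rep p zero    β refl = trans (E-rep-< (suc p) R 0 (ℕ.+-identityʳ R) (ℕ.>-nonZero⁻¹ R))
                                 (ℕ.+-identityʳ (R * e (suc p)))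
  E-rep p (suc α) β sum  = E-rep-< p (suc α) β sum (subst (β <_) sum (s≤s (ℕ.m≤n+m β α)))

  E-suc : ∀ s → E s < E (suc s)
  E-suc s with represent s
  ... | rep p zero    β sum refl β<R = contradiction sum (ℕ.<⇒≢ β<R)
  ... | rep p (suc α) β sum refl β<R = subst₂ _<_
    (sym (E-rep p (suc α) β sum)) (sym (E-rep p α (suc β) (trans (ℕ.+-suc α β) sum)))
    (begin-strict
      (e p + α * e p) + β * e (suc p)         ≡⟨ rearrange (e p) (α * e p) (β * e (suc p)) ⟩
      α * e p + (e p + β * e (suc p))         <⟨ ℕ.+-monoʳ-< (α * e p) (ℕ.+-monoˡ-< (β * e (suc p)) (e-<-suc p)) ⟩
      α * e p + (e (suc p) + β * e (suc p))   ∎)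
    where
    open ℕ.≤-Reasoning
    rearrange : ∀ x y z → x + y + z ≡ y + (x + z)
    rearrange = solve-∀

  E-mono : ∀ {s t} → s ≤ t → E s ≤ E t
  E-mono {s} {t} s≤t = subst (λ z → E s ≤ E z) (ℕ.m∸n+n≡m s≤t) (up (t ∸ s))
    where
    up : ∀ d → E s ≤ E (d + s)
    up zero    = ℕ.≤-refl
    up (suc d) = ℕ.≤-trans (up d) (ℕ.<⇒≤ (E-suc (d + s)))

  E-cancel-≤ : ∀ {s t} → E s ≤ E t → s ≤ t
  E-cancel-≤ {s} {t} le = ℕ.≮⇒≥ λ t<s → ℕ.<⇒≱ (ℕ.<-≤-trans (E-suc t) (E-mono t<s)) le

  weighted-mono : ∀ a₁ a₂ a₃ {x₁ x₂ x₃ y₁ y₂ y₃} → x₁ ≤ y₁ → x₂ ≤ y₂ → x₃ ≤ y₃ →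
    a₁ * x₁ + a₂ * x₂ + a₃ * x₃ ≤ a₁ * y₁ + a₂ * y₂ + a₃ * y₃
  weighted-mono a₁ a₂ a₃ p₁ p₂ p₃ = ℕ.+-mono-≤ (ℕ.+-mono-≤ (ℕ.*-monoʳ-≤ a₁ p₁) (ℕ.*-monoʳ-≤ a₂ p₂)) (ℕ.*-monoʳ-≤ a₃ p₃)

  add-total : ∀ a₁ a₂ a₃ x₁ x₂ x₃ → a₁ + a₂ + a₃ ≡ R →
    a₁ * x₁ + a₂ * x₂ + a₃ * x₃ + R ≡ a₁ * suc x₁ + a₂ * suc x₂ + a₃ * suc x₃
  add-total a₁ a₂ a₃ x₁ x₂ x₃ sum =
    trans (cong (λ z → a₁ * x₁ + a₂ * x₂ + a₃ * x₃ + z) (sym sum)) (spread a₁ a₂ a₃ x₁ x₂ x₃)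
    where
    spread : ∀ d b b′ x y z → d * x + b * y + b′ * z + (d + b + b′) ≡ d * suc x + b * suc y + b′ * suc z
    spread = solve-∀

  Additive : ℕ → ℕ → Set
  Additive s t = E s + E t ≤ E (s + t) × E (s + t) ≤ E s + E t + R

  -- With s/R = p + β/R and t/R = q + β′/R, both sides become sums of three values
  -- of e with the same weights, and e-super and e-sub apply termwise; which
  -- weights depends on whether the fractional parts carry.
  additive : ∀ s t → Additive s t
  additive s t with represent s | represent t
  ... | rep p α β sum refl _ | rep q α′ β′ sum′ refl _ with ℕ.≤-total (β + β′) R
  ...   | inj₁ β+β′≤R =
    subst₂ _≤_ (sym parts) (sym whole)
      (weighted-mono δ β β′ (e-super p q) (e-super (suc p) q)
        (subst (λ z → e p + e (suc q) ≤ e z) (ℕ.+-suc p q) (e-super p (suc q)))) ,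
    subst₂ _≤_ (sym whole) (sym (trans (cong (_+ R) parts) slack))
      (weighted-mono δ β β′ (e-sub p q) (e-sub (suc p) q)
        (subst (λ z → e z ≤ suc (e p + e (suc q))) (ℕ.+-suc p q) (e-sub p (suc q))))
    where
    δ = R ∸ (β + β′)
    δ-sum : δ + (β + β′) ≡ R
    δ-sum = ℕ.m∸n+n≡m β+β′≤R
    α≡ : α ≡ δ + β′
    α≡ = ℕ.+-cancelʳ-≡ β α (δ + β′) (trans sum (trans (sym δ-sum) (swap δ β β′)))
      where
      swap : ∀ x y z → x + (y + z) ≡ x + z + y
      swap = solve-∀
    α′≡ : α′ ≡ δ + β
    α′≡ = ℕ.+-cancelʳ-≡ β′ α′ (δ + β) (trans sum′ (trans (sym δ-sum) (sym (ℕ.+-assoc δ β β′))))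
    parts : E (β + p * R) + E (β′ + q * R)
          ≡ δ * (e p + e q) + β * (e (suc p) + e q) + β′ * (e p + e (suc q))
    parts rewrite E-rep p α β sum | E-rep q α′ β′ sum′ | α≡ | α′≡ = regroup δ β β′ (e p) (e (suc p)) (e q) (e (suc q))
      where
      regroup : ∀ d b b′ x x′ y y′ → ((d + b′) * x + b * x′) + ((d + b) * y + b′ * y′)
              ≡ d * (x + y) + b * (x′ + y) + b′ * (x + y′)
      regroup = solve-∀
    whole : E (β + p * R + (β′ + q * R))
          ≡ δ * e (p + q) + β * e (suc (p + q)) + β′ * e (suc (p + q))
    whole = trans (cong E (gather β β′ p q R)) (trans (E-rep (p + q) δ (β + β′) δ-sum)
      (expand (δ * e (p + q)) β β′ (e (suc (p + q)))))
      where
      gather : ∀ b b′ p q R → b + p * R + (b′ + q * R) ≡ (b + b′) + (p + q) * R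
      gather = solve-∀
      expand : ∀ z b b′ x → z + (b + b′) * x ≡ z + b * x + b′ * x
      expand = solve-∀
    slack = add-total δ β β′ (e p + e q) (e (suc p) + e q) (e p + e (suc q))
      (trans (ℕ.+-assoc δ β β′) δ-sum)
  ...   | inj₂ R≤β+β′ =
    subst₂ _≤_ (sym parts) (sym whole)
      (weighted-mono α α′ δ
        (subst (λ z → e p + e (suc q) ≤ e z) (ℕ.+-suc p q) (e-super p (suc q)))
        (e-super (suc p) q)
        (subst (λ z → e (suc p) + e (suc q) ≤ e z) (cong suc (ℕ.+-suc p q)) (e-super (suc p) (suc q)))) ,
    subst₂ _≤_ (sym whole) (sym (trans (cong (_+ R) parts) slack))
      (weighted-mono α α′ δ
        (subst (λ z → e z ≤ suc (e p + e (suc q))) (ℕ.+-suc p q) (e-sub p (suc q)))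
        (e-sub (suc p) q)
        (subst (λ z → e z ≤ suc (e (suc p) + e (suc q))) (cong suc (ℕ.+-suc p q)) (e-sub (suc p) (suc q))))
    where
    δ = β + β′ ∸ R
    δ-sum : δ + R ≡ β + β′
    δ-sum = ℕ.m∸n+n≡m R≤β+β′
    β′≡ : β′ ≡ δ + α
    β′≡ = ℕ.+-cancelʳ-≡ β β′ (δ + α) (trans (ℕ.+-comm β′ β) (trans (sym δ-sum)
      (trans (cong (δ +_) (sym sum)) (sym (ℕ.+-assoc δ α β)))))
    β≡ : β ≡ δ + α′
    β≡ = ℕ.+-cancelʳ-≡ β′ β (δ + α′) (trans (sym δ-sum)
      (trans (cong (δ +_) (sym sum′)) (sym (ℕ.+-assoc δ α′ β′))))
    weights : α + α′ + δ ≡ R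
    weights = trans (ℕ.+-assoc α α′ δ) (trans (cong (α +_) (trans (ℕ.+-comm α′ δ) (sym β≡))) sum)
    parts : E (β + p * R) + E (β′ + q * R)
          ≡ α * (e p + e (suc q)) + α′ * (e (suc p) + e q) + δ * (e (suc p) + e (suc q))
    parts = trans (cong₂ _+_ (E-rep p α β sum) (E-rep q α′ β′ sum′))
      (trans (cong₂ (λ y z → α * e p + y * e (suc p) + (α′ * e q + z * e (suc q))) β≡ β′≡)
        (regroup δ α α′ (e p) (e (suc p)) (e q) (e (suc q))))
      where
      regroup : ∀ d a a′ x x′ y y′ → (a * x + (d + a′) * x′) + (a′ * y + (d + a) * y′)
              ≡ a * (x + y′) + a′ * (x′ + y) + d * (x′ + y′)
      regroup = solve-∀
    whole : E (β + p * R + (β′ + q * R))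
          ≡ α * e (suc (p + q)) + α′ * e (suc (p + q)) + δ * e (suc (suc (p + q)))
    whole = trans (cong E (trans (gather β β′ p q R) (trans (cong (_+ (p + q) * R) (sym δ-sum)) (ℕ.+-assoc δ R _))))
      (trans (E-rep (suc (p + q)) (α + α′) δ weights)
        (cong (_+ δ * e (suc (suc (p + q)))) (ℕ.*-distribʳ-+ (e (suc (p + q))) α α′)))
      where
      gather : ∀ b b′ p q R → b + p * R + (b′ + q * R) ≡ (b + b′) + (p + q) * R
      gather = solve-∀
    slack = add-total α α′ δ (e p + e (suc q)) (e (suc p) + e q) (e (suc p) + e (suc q)) weights

  -- Offset `i` in segment `j` is the fraction `i * ρ j / R = i / len j` of the segment, and
  -- interpolating `e` over that fraction adds `i` vertices.
  E-Z : ∀ x → E (Z x) ≡ R * x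
  E-Z x with locate x
  ... | pos j i refl i<len = trans (E-rep j α (i * ρ j) α-sum) (begin
    α * e j + i * ρ j * e (suc j)             ≡⟨ cong (λ z → α * e j + i * ρ j * z) (e-suc j) ⟩
    α * e j + i * ρ j * (e j + len j)         ≡⟨ regroup α i (ρ j) (e j) (len j) ⟩
    (α + i * ρ j) * e j + len j * ρ j * i     ≡⟨ cong₂ (λ y z → y * e j + z * i) α-sum (len*ρ j) ⟩
    R * e j + R * i                           ≡⟨ ℕ.*-distribˡ-+ R (e j) i ⟨
    R * (e j + i)                             ∎)
    where
    open ≡-Reasoning
    α = R ∸ i * ρ j
    α-sum : α + i * ρ j ≡ R
    α-sum = ℕ.m∸n+n≡m (subst (i * ρ j ≤_) (len*ρ j) (ℕ.*-monoˡ-≤ (ρ j) (ℕ.<⇒≤ i<len)))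
    regroup : ∀ a i ρ x l → a * x + i * ρ * (x + l) ≡ (a + i * ρ) * x + l * ρ * i
    regroup = solve-∀

  -- Since `E` is increasing and inverts `Z` up to the factor `R`, its superadditivity becomes
  -- subadditivity of `Z`.
  Z-sub : ∀ x a → Z (x + a) ≤ Z x + Z a
  Z-sub x a = E-cancel-≤ (begin
    E (Z (x + a))        ≡⟨ E-Z (x + a) ⟩
    R * (x + a)          ≡⟨ ℕ.*-distribˡ-+ R x a ⟩
    R * x + R * a        ≡⟨ cong₂ _+_ (E-Z x) (E-Z a) ⟨
    E (Z x) + E (Z a)    ≤⟨ proj₁ (additive (Z x) (Z a)) ⟩
    E (Z x + Z a)        ∎)
    where open ℕ.≤-Reasoning

  -- The same duality: the slack `R` on the side of `E` is worth one vertex.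
  Z-sup : ∀ x a → Z x + Z a ≤ Z (suc (x + a))
  Z-sup x a = E-cancel-≤ (begin
    E (Z x + Z a)            ≤⟨ proj₂ (additive (Z x) (Z a)) ⟩
    E (Z x) + E (Z a) + R    ≡⟨ cong₂ (λ y z → y + z + R) (E-Z x) (E-Z a) ⟩
    R * x + R * a + R        ≡⟨ factor R x a ⟩
    R * suc (x + a)          ≡⟨ E-Z (suc (x + a)) ⟨
    E (Z (suc (x + a)))      ∎)
    where
    open ℕ.≤-Reasoning
    factor : ∀ R x a → R * x + R * a + R ≡ R * suc (x + a)
    factor = solve-∀

  -- `E` agrees on both sides and is strictly increasing. The cases `j = h` and `j = w` yield `Z c`
  -- and the total weight.
  Z-e : ∀ j → Z (e j) ≡ j * R
  Z-e j = ℕ.≤-antisym (E-cancel-≤ (ℕ.≤-reflexive same)) (E-cancel-≤ (ℕ.≤-reflexive (sym same)))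
    where
    same : E (Z (e j)) ≡ E (j * R)
    same = trans (E-Z (e j)) (sym (trans (E-rep j R 0 (ℕ.+-identityʳ R)) (ℕ.+-identityʳ (R * e j))))

-- Unfolding the loop of the segment construction.

segLen : ℕ → ℕ → ℕ → ℕ → ℚ → ℕ
segLen c h w v acc =
  if frac ((v + divN c h) * h) (w * c) ℚ.≤ᵇ (acc ℚ.+ frac 1 w) then suc (divN c h) else divN c h

-- A named copy of the loop inside `segY`, about which inductions on the fuel can be stated.
segGo : ℕ → ℕ → ℕ → ℕ → ℕ → ℕ → ℕ → ℚ → ℚ
segGo c n h w i zero v acc = 0ℚ
segGo c n h w i (suc f) v acc =
  if (n ∸ 2) <ᵇ v then 0ℚ else
    (if (v ≤ᵇ i) ∧ (i <ᵇ v + segLen c h w v acc) then frac 1 (segLen c h w v acc * w)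
     else segGo c n h w i f (v + segLen c h w v acc) (acc ℚ.+ frac 1 w))

-- The local loop of segY has no name outside Defs.  Here segGo′ is a
-- metavariable that Agda solves by that loop: the last with-abstraction in
-- segY≡segGo turns all its arguments into distinct variables.
mutual
  segGo′ : ℕ → ℕ → ℕ → ℕ → ℕ → ℕ → ℕ → ℚ → ℚ
  segGo′ = _

  segY≡segGo : ∀ c n h w i → segY c n h w i ≡ segGo c n h w i n 1 0ℚ
  segY≡segGo c zero h w i = refl
  segY≡segGo c (suc n) h w i with suc n ∸ 2 <ᵇ 1
  ... | true = refl
  ... | false with segLen c h w 1 0ℚ
  ...   | l with (1 ≤ᵇ i) ∧ (i <ᵇ 1 + l)
  ...     | true = refl
  ...     | false with suc n | 1 + l | 0ℚ ℚ.+ frac 1 w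
  ...       | n′ | v | acc = go≡segGo c n′ h w i n v acc

  go≡segGo : ∀ c n h w i f v acc → segGo′ c n h w i f v acc ≡ segGo c n h w i f v acc
  go≡segGo c n h w i zero v acc = refl
  go≡segGo c n h w i (suc f) v acc with n ∸ 2 <ᵇ v
  ... | true = refl
  ... | false with segLen c h w v acc
  ...   | l with (v ≤ᵇ i) ∧ (i <ᵇ v + l)
  ...     | true = refl
  ...     | false = go≡segGo c n h w i f (v + l) (acc ℚ.+ frac 1 w)

<ᵇ-true : ∀ {m n} → m < n → (m <ᵇ n) ≡ true
<ᵇ-true {m} {n} m<n with m <ᵇ n | ℕ.<⇒<ᵇ m<n
... | true | _ = refl

<ᵇ-false : ∀ {m n} → n ≤ m → (m <ᵇ n) ≡ false
<ᵇ-false {m} {n} n≤m with m <ᵇ n | ℕ.<ᵇ⇒< m n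
... | false | _  = refl
... | true  | lt = contradiction (lt tt) (ℕ.≤⇒≯ n≤m)

divN-/ : ∀ m n .{{_ : NonZero n}} → divN m n ≡ m / n
divN-/ m (suc n) = refl

-- Guarantee of the segment construction.

module SegmentHider (c h : ℕ) .{{_ : NonZero h}} (h≤c : h ≤ c)
  (M w : ℕ) .{{_ : NonZero w}} (w≤M : w ≤ M) (h*N≡w*c+1 : h * suc M ≡ w * c + 1) where

  open Segments c h h≤c
  open Position

  instance
    w*c-nonZero : NonZero (w * c)
    w*c-nonZero = ℕ.m*n≢0 w c {{it}} {{ℕ.>-nonZero (ℕ.<-≤-trans (ℕ.>-nonZero⁻¹ h) h≤c)}}

  -- `w * c` equals `M * h + (h - 1)`, whose quotient by `h` is `M`. So exactly `w` segments fill
  -- the inner vertices.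
  e-w : e w ≡ M
  e-w = trans (cong (_/ h) (ℕ.+-cancelʳ-≡ 1 (w * c) (h ∸ 1 + M * h) (trans (sym h*N≡w*c+1) expand)))
    ([m+k*n]/n≡k M h (ℕ.≤-reflexive 1+[h∸1]))
    where
    1+[h∸1] : suc (h ∸ 1) ≡ h
    1+[h∸1] = ℕ.suc-pred h
    expand : h * suc M ≡ h ∸ 1 + M * h + 1
    expand = trans (ℕ.*-suc h M) (trans (cong₂ _+_ (trans (sym 1+[h∸1]) (ℕ.+-comm 1 (h ∸ 1))) (ℕ.*-comm h M)) (swap (h ∸ 1) 1 (M * h)))
      where
      swap : ∀ x y z → x + y + z ≡ x + z + y
      swap = solve-∀

  e-h : e h ≡ c
  e-h = trans (cong (_/ h) (ℕ.*-comm h c)) (m*n/n≡m c h)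

  Z-M : Z M ≡ w * R
  Z-M = trans (cong Z (sym e-w)) (Z-e w)

  Z-c : Z c ≡ h * R
  Z-c = trans (cong Z (sym e-h)) (Z-e h)

  segWeight : ℕ → ℕ
  segWeight zero    = 0
  segWeight (suc x) = if x <ᵇ M then ρ (seg (locate x)) else 0

  segWeight-step : ∀ v → v < M → segWeight (suc v) + Z v ≡ Z (suc v)
  segWeight-step v v<M = trans (cong (λ b → (if b then ρ (seg (locate v)) else 0) + Z v) (<ᵇ-true v<M)) (Z-step v)

  segWeight-end : ∀ v → M ≤ v → segWeight (suc v) ≡ 0
  segWeight-end v M≤v = cong (λ b → if b then ρ (seg (locate v)) else 0) (<ᵇ-false M≤v)

  n : ℕ
  n = suc (suc M)

  -- The loop tests length `r + 1` at its last vertex `e j + 1 + r`. Cleared of denominators, the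
  -- test is `(e j + 1 + r) * h ≤ suc j * c`, that is `e j + 1 + r ≤ e (suc j)`, which tells the two
  -- possible values of `len j` apart.
  segLen≡len : ∀ j → segLen c h w (suc (e j)) (frac j w) ≡ len j
  segLen≡len j = choose (len-cases j) _ refl
    where
    div≡ : divN c h ≡ r
    div≡ = divN-/ c h
    mass : frac j w ℚ.+ frac 1 w ≡ frac (suc j) w
    mass = trans (frac-+ j 1 w) (cong (λ z → frac z w) (ℕ.+-comm j 1))
    fits : ∀ {a} → frac (a * h) (w * c) ℚ.≤ frac (suc j) w → a ≤ e (suc j)
    fits {a} le = *≤⇒≤/ h (ℕ.*-cancelʳ-≤ (a * h) (suc j * c) w
      (ℕ.≤-trans (frac-cancel-≤ {a * h} {w * c} {suc j} {w} le) (ℕ.≤-reflexive (swap (suc j) w c))))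
      where
      swap : ∀ x y z → x * (y * z) ≡ x * z * y
      swap = solve-∀
    fits⁻ : ∀ {a} → a ≤ e (suc j) → frac (a * h) (w * c) ℚ.≤ frac (suc j) w
    fits⁻ {a} le = frac-mono-≤ {a * h} {w * c} {suc j} {w}
      (ℕ.≤-trans (ℕ.*-monoˡ-≤ w (≤/⇒*≤ h le)) (ℕ.≤-reflexive (swap (suc j) w c)))
      where
      swap : ∀ x y z → x * z * y ≡ x * (y * z)
      swap = solve-∀
    choose : len j ≡ r ⊎ len j ≡ suc r → ∀ b →
      (frac ((suc (e j) + divN c h) * h) (w * c) ℚ.≤ᵇ (frac j w ℚ.+ frac 1 w)) ≡ b →
      (if b then suc (divN c h) else divN c h) ≡ len j
    choose cases b eq rewrite div≡ | mass with b | cases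
    ... | true  | inj₂ len≡ = sym len≡
    ... | false | inj₁ len≡ = sym len≡
    ... | true  | inj₁ len≡ = contradiction
      (ℕ.≤-reflexive (trans (e-suc j) (cong (e j +_) len≡)))
      (ℕ.<⇒≱ (fits (ℚ.≤ᵇ⇒≤ (subst T (sym eq) tt))))
    ... | false | inj₂ len≡ = contradiction
      (subst T eq (ℚ.≤⇒≤ᵇ (fits⁻ (ℕ.≤-reflexive (sym (trans (e-suc j) (trans (cong (e j +_) len≡) (ℕ.+-suc (e j) r))))))))
      λ ()

  -- This carries the loop invariant: round `j` starts at vertex `suc (e j)` with mass `j / w`
  -- already assigned.
  segGo-step : ∀ i f j → segGo c n h w i (suc f) (suc (e j)) (frac j w) ≡
    (if M <ᵇ suc (e j) then 0ℚ else
      (if (e j <ᵇ i) ∧ (i <ᵇ suc (e (suc j))) then frac 1 (len j * w)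
       else segGo c n h w i f (suc (e (suc j))) (frac (suc j) w)))
  segGo-step i f j
    rewrite segLen≡len j | frac-+ j 1 w | ℕ.+-comm j 1 | sym (e-suc j) = refl

  -- `M = e w` is itself a breakpoint, so no segment straddles it.
  e-suc-≤M : ∀ j → e j < M → e (suc j) ≤ M
  e-suc-≤M j e<M = ℕ.≤-trans (e-mono {suc j} {w} (e-cancel-< {j} {w} (subst (e j <_) (sym e-w) e<M))) (ℕ.≤-reflexive e-w)

  segGo-outside : ∀ i f j → i ≤ e j ⊎ M < i → segGo c n h w i f (suc (e j)) (frac j w) ≡ 0ℚ
  segGo-outside i zero    j _ = refl
  segGo-outside i (suc f) j out rewrite segGo-step i f j with M ℕ.<? suc (e j)
  ... | yes M<1+e rewrite <ᵇ-true M<1+e = refl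
  ... | no  M≮1+e rewrite <ᵇ-false (ℕ.≮⇒≥ M≮1+e) with out
  ...   | inj₁ i≤e rewrite <ᵇ-false i≤e =
    segGo-outside i f (suc j) (inj₁ (ℕ.≤-trans i≤e (ℕ.<⇒≤ (e-<-suc j))))
  ...   | inj₂ M<i rewrite <ᵇ-true (ℕ.≤-<-trans (ℕ.<⇒≤ (ℕ.≮⇒≥ M≮1+e)) M<i) | <ᵇ-false {i} {suc (e (suc j))} (ℕ.≤-<-trans (e-suc-≤M j (ℕ.≮⇒≥ M≮1+e)) M<i) =
    segGo-outside i f (suc j) (inj₂ M<i)

  -- The bound `l < f + j` states that the fuel lasts until round `l`.
  segGo-inside : ∀ x l f j → e l ≤ x → x < e (suc l) → l < w → j ≤ l → l < f + j →
    segGo c n h w (suc x) f (suc (e j)) (frac j w) ≡ frac 1 (len l * w)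
  segGo-inside x l zero    j lo hi l<w j≤l fuel = contradiction fuel (ℕ.≤⇒≯ j≤l)
  segGo-inside x l (suc f) j lo hi l<w j≤l fuel
    rewrite segGo-step (suc x) f j
          | <ᵇ-false {M} {suc (e j)} (ℕ.≤-<-trans (ℕ.≤-trans (e-mono j≤l) lo)
              (ℕ.<-≤-trans hi (ℕ.≤-trans (e-mono l<w) (ℕ.≤-reflexive e-w))))
          | <ᵇ-true {e j} {suc x} (s≤s (ℕ.≤-trans (e-mono j≤l) lo))
    with ℕ.m≤n⇒m<n∨m≡n j≤l
  ... | inj₂ refl rewrite <ᵇ-true hi = refl
  ... | inj₁ j<l rewrite <ᵇ-false (ℕ.≤-trans (e-mono j<l) lo) =
    segGo-inside x l f (suc j) lo hi l<w j<l (subst (l <_) (sym (ℕ.+-suc f j)) fuel)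

  segGo-start : ∀ i → segY c n h w i ≡ segGo c n h w i n (suc (e 0)) (frac 0 w)
  segGo-start i = trans (segY≡segGo c n h w i)
    (cong₂ (λ v a → segGo c n h w i n v a) (cong suc (sym e-zero)) (sym (frac-0 w)))

  instance
    Z-M-nonZero : NonZero (Z M)
    Z-M-nonZero = subst NonZero (sym Z-M) (ℕ.m*n≢0 w R)

  segY≡weight : ∀ v → segY c n h w v ≡ frac (segWeight v) (Z M)
  segY≡weight zero    = trans (segGo-start 0) (trans (segGo-outside 0 n 0 (inj₁ z≤n)) (sym (frac-0 (Z M))))
  segY≡weight (suc x) with x ℕ.<? M
  ... | no  x≮M = trans (segGo-start (suc x)) (trans (segGo-outside (suc x) n 0 (inj₂ (s≤s (ℕ.≮⇒≥ x≮M))))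
    (sym (trans (cong (λ z → frac z (Z M)) (segWeight-end x (ℕ.≮⇒≥ x≮M))) (frac-0 (Z M)))))
  ... | yes x<M = trans (segGo-start (suc x)) (trans
    (segGo-inside x l n 0 lo hi l<w z≤n
      (ℕ.<-≤-trans l<w (ℕ.≤-trans w≤M (ℕ.≤-trans (ℕ.m≤n+m M 2) (ℕ.≤-reflexive (sym (ℕ.+-identityʳ n)))))))
    (trans (frac-≡ {1} {len l * w} {ρ l} {Z M} {{ℕ.m*n≢0 (len l) w {{ℕ.>-nonZero (0<len l)}}}} cross)
      (cong (λ b → frac (if b then ρ l else 0) (Z M)) (sym (<ᵇ-true x<M)))))
    where
    l = seg (locate x)
    lo : e l ≤ x
    lo = subst (e l ≤_) (sym (split (locate x))) (ℕ.m≤m+n _ (off (locate x)))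
    hi : x < e (suc l)
    hi = subst₂ _<_ (sym (split (locate x))) (sym (e-suc l)) (ℕ.+-monoʳ-< (e l) (inside (locate x)))
    l<w : l < w
    l<w = e-cancel-< (ℕ.≤-<-trans lo (subst (x <_) (sym e-w) x<M))
    cross : 1 * Z M ≡ ρ l * (len l * w)
    cross = begin
      1 * Z M              ≡⟨ ℕ.*-identityˡ (Z M) ⟩
      Z M                  ≡⟨ Z-M ⟩
      w * R                ≡⟨ cong (w *_) (len*ρ l) ⟨
      w * (len l * ρ l)    ≡⟨ reorder w (len l) (ρ l) ⟩
      ρ l * (len l * w)    ∎
      where
      open ≡-Reasoning
      reorder : ∀ x y z → x * (y * z) ≡ z * (y * x)
      reorder = solve-∀

  segY-guarantee : ∀ {k} → 2 ^ k ≡ suc (suc c) → 2 ^ k < n → HiderGuarantee k n (frac h w) (segY c n h w)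
  segY-guarantee {k} 2^k≡ 2^k<n = hiderGuarantee {c} {k} {h} {w} (segY c n h w) 2^k≡ 2^k<n
    (trans (cong (_* w) Z-c) (trans (swap h R w) (cong (h *_) (sym Z-M))))
    (λ v _ → segY≡weight v)
    where
    open Profile Z Z-zero Z-sub Z-sup M segWeight refl segWeight-step (segWeight-end M ℕ.≤-refl) using (hiderGuarantee)
    swap : ∀ x y z → x * y * z ≡ x * (z * y)
    swap = solve-∀

-- Guarantee of the hider who avoids the multiples of `d`.

module DivisorHider (d′ h w M : ℕ) .{{_ : NonZero d′}} .{{_ : NonZero w}} (N≡w*d : suc M ≡ w * suc d′) where

  d : ℕ
  d = suc d′

  -- The number of non-multiples of `d` among 1, ..., `v`.
  Z : ℕ → ℕ
  Z v = v ∸ v / d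

  Z+/ : ∀ v → Z v + v / d ≡ v
  Z+/ v = ℕ.m∸n+n≡m (m/n≤m v d)

  Z-unique : ∀ {z} v → z + v / d ≡ v → z ≡ Z v
  Z-unique v eq = ℕ.+-cancelʳ-≡ (v / d) _ (Z v) (trans eq (sym (Z+/ v)))

  Z-* : ∀ k → Z (k * d) ≡ k * d′
  Z-* k = sym (Z-unique (k * d) (trans (cong (k * d′ +_) (m*n/n≡m k d)) (trans (ℕ.+-comm (k * d′) k) (sym (ℕ.*-suc k d′)))))

  split : ∀ x a → (Z x + Z a) + (x / d + a / d) ≡ x + a
  split x a = trans (swap (Z x) (Z a) (x / d) (a / d)) (cong₂ _+_ (Z+/ x) (Z+/ a))
    where
    swap : ∀ p q r s → (p + q) + (r + s) ≡ (p + r) + (q + s)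
    swap = solve-∀

  Z-sub : ∀ x a → Z (x + a) ≤ Z x + Z a
  Z-sub x a = ℕ.+-cancelʳ-≤ ((x + a) / d) (Z (x + a)) (Z x + Z a) (begin
    Z (x + a) + (x + a) / d            ≡⟨ Z+/ (x + a) ⟩
    x + a                              ≡⟨ split x a ⟨
    (Z x + Z a) + (x / d + a / d)      ≤⟨ ℕ.+-monoʳ-≤ (Z x + Z a) (/-super x a d) ⟩
    (Z x + Z a) + (x + a) / d          ∎)
    where open ℕ.≤-Reasoning

  Z-sup : ∀ x a → Z x + Z a ≤ Z (suc (x + a))
  Z-sup x a = ℕ.+-cancelʳ-≤ (suc (x + a) / d) (Z x + Z a) (Z (suc (x + a))) (begin
    (Z x + Z a) + suc (x + a) / d            ≤⟨ ℕ.+-monoʳ-≤ (Z x + Z a) (/-sub x a d) ⟩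
    (Z x + Z a) + suc (x / d + a / d)        ≡⟨ ℕ.+-suc (Z x + Z a) _ ⟩
    suc ((Z x + Z a) + (x / d + a / d))      ≡⟨ cong suc (split x a) ⟩
    suc (x + a)                              ≡⟨ Z+/ (suc (x + a)) ⟨
    Z (suc (x + a)) + suc (x + a) / d        ∎)
    where open ℕ.≤-Reasoning

  offMultiple : ℕ → ℕ
  offMultiple v = if v % d ≡ᵇ 0 then 0 else 1

  offMultiple-step : ∀ v → offMultiple (suc v) + Z v ≡ Z (suc v)
  offMultiple-step v = Z-unique (suc v) (by-residue (suc v % d) (suc v / d) (m%n<n (suc v) d) (m≡m%n+[m/n]*n (suc v) d))
    where
    by-residue : ∀ b q → b < d → suc v ≡ b + q * d → (if b ≡ᵇ 0 then 0 else 1) + Z v + q ≡ suc v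
    -- At a multiple of `d` the quotient has just grown from `q` to `suc q`, which matches the
    -- weight 0.
    by-residue zero    (suc q) _ eq = begin
      Z v + suc q        ≡⟨ ℕ.+-suc (Z v) q ⟩
      suc (Z v + q)      ≡⟨ cong (λ z → suc (Z v + z)) v/d≡q ⟨
      suc (Z v + v / d)  ≡⟨ cong suc (Z+/ v) ⟩
      suc v              ∎
      where
      open ≡-Reasoning
      v/d≡q : v / d ≡ q
      v/d≡q = trans (cong (_/ d) (ℕ.suc-injective eq)) ([m+k*n]/n≡k q d ℕ.≤-refl)
    by-residue (suc b) q 1+b<d eq = cong suc (trans (cong (Z v +_) (sym v/d≡q)) (Z+/ v))
      where
      v/d≡q : v / d ≡ q
      v/d≡q = trans (cong (_/ d) (ℕ.suc-injective eq)) ([m+k*n]/n≡k q d (ℕ.<⇒≤ 1+b<d))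

  offMultiple-last : offMultiple (suc M) ≡ 0
  offMultiple-last = cong (λ z → if z ≡ᵇ 0 then 0 else 1) (trans (cong (_% d) N≡w*d) (m*n%n≡0 w d))

  -- The end vertex `w * d` is a multiple of `d` and weighs nothing, so `Z M = Z (w * d)`.
  Z-M : Z M ≡ w * d′
  Z-M = trans (cong (_+ Z M) (sym offMultiple-last)) (trans (offMultiple-step M) (trans (cong Z N≡w*d) (Z-* w)))

  instance
    Z-M-nonZero : NonZero (Z M)
    Z-M-nonZero = subst NonZero (sym Z-M) (ℕ.m*n≢0 w d′)

  yDiv-guarantee : ∀ {k} → 2 ^ k ≡ suc (suc (h * d)) → 2 ^ k < suc (suc M) →
    HiderGuarantee k (suc (suc M)) (frac h w) (yDiv d w)
  yDiv-guarantee {k} 2^k≡ 2^k<n = hiderGuarantee {h * d} {k} {h} {w} (yDiv d w) 2^k≡ 2^k<n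
    (trans (cong (_* w) (Z-* h)) (trans (swap h d′ w) (cong (h *_) (sym Z-M))))
    (λ v _ → weight v (v % d ≡ᵇ 0))
    where
    open Profile Z refl Z-sub Z-sup M offMultiple refl (λ v _ → offMultiple-step v) offMultiple-last using (hiderGuarantee)
    swap : ∀ x y z → x * y * z ≡ x * (z * y)
    swap = solve-∀
    weight : ∀ v b → (if b then 0ℚ else frac 1 (w * d′)) ≡ frac (if b then 0 else 1) (Z M)
    weight v true  = sym (frac-0 (Z M))
    weight v false = cong (frac 1) (sym Z-M)

-- Counting hits by jumps of a floor function.

bit : Bool → ℕ
bit b = if b then 1 else 0

-- The jump of the floor across (x, x + c] comes from a multiple q N in that window.
floor-step : ∀ x c N .{{_ : NonZero N}} b → c ≤ N →
  (∀ q t → suc x + t ≡ q * N → t < c → b ≡ true) → (x + c) / N ≤ bit b + x / N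
floor-step x c N b c≤N hit with ℕ.<-≤-connex (x / N) ((x + c) / N)
... | inj₂ ≤old = ℕ.≤-trans ≤old (ℕ.m≤n+m (x / N) (bit b))
... | inj₁ old< = subst (λ b → (x + c) / N ≤ bit b + x / N) (sym b≡true) (ℕ.≤-pred (m<n*o⇒m/o<n {o = N} (begin-strict
    x + c                      <⟨ ℕ.+-mono-<-≤ (<*suc/ x N) c≤N ⟩
    suc (x / N) * N + N        ≡⟨ ℕ.+-comm (suc (x / N) * N) N ⟩
    suc (suc (x / N)) * N      ∎)))
  where
  open ℕ.≤-Reasoning
  q = (x + c) / N
  t = q * N ∸ suc x
  x<qN : x < q * N
  x<qN = ℕ.<-≤-trans (<*suc/ x N) (ℕ.*-monoˡ-≤ N old<)
  1+x+t : suc x + t ≡ q * N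
  1+x+t = ℕ.m+[n∸m]≡n x<qN
  t<c : t < c
  t<c = ℕ.+-cancelˡ-≤ x (suc t) c (ℕ.≤-trans (ℕ.≤-reflexive (trans (ℕ.+-suc x t) 1+x+t)) (m/n*n≤m (x + c) N))
  b≡true : b ≡ true
  b≡true = hit q t 1+x+t t<c

countTrue : List ℕ → (ℕ → Bool) → ℕ
countTrue []       b = 0
countTrue (v ∷ vs) b = bit (b v) + countTrue vs b

module Uniform (n L : ℕ) (S : ℕ → SG n) where

  entry : ℕ → SG n × ℚ
  entry v = S v , frac 1 L

  total : ∀ vs → sumQ (map proj₂ (map entry vs)) ≡ frac (length vs) L
  total []       = sym (frac-0 L)
  total (v ∷ vs) = trans (cong (frac 1 L ℚ.+_) (total vs)) (frac-+ 1 (length vs) L)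

  coverProb-uniform : ∀ u vs → coverProb n (map entry vs) u ≡ frac (countTrue vs (λ v → covers (S v) u)) L
  coverProb-uniform u []       = sym (frac-0 L)
  coverProb-uniform u (v ∷ vs) =
    trans (cong₂ ℚ._+_ (masked (covers (S v) u)) (coverProb-uniform u vs)) (frac-+ (bit (covers (S v) u)) _ L)
    where
    masked : ∀ b → (if b then frac 1 L else 0ℚ) ≡ frac (bit b) L
    masked true  = refl
    masked false = sym (frac-0 L)

  valid : ∀ k vs → All (λ v → height (S v) ≤ k) vs →
    All (λ p → height (proj₁ p) ≤ k × 0ℚ ℚ.≤ proj₂ p) (map entry vs)
  valid k []       []       = []
  valid k (v ∷ vs) (p ∷ ps) = (p , frac-nonneg 1 L) ∷ valid k vs ps

-- The greedy strategy of the seeker.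

module Greedy (k c M h w : ℕ) .{{_ : NonZero h}} .{{_ : NonZero w}}
  (c+2≤N : suc (suc c) ≤ suc M) (w≤n : w ≤ suc M) (h*N≤w*c+1 : h * suc M ≤ w * c + 1)
  (interior : ∀ j → 0 < j → j < w → 2 ≤ suc (j * c) % suc M)
  (return : suc (w * c) % suc M < 2)
  (S : ℕ → SG (suc (suc M))) (efficient : Efficient k (suc (suc M)) c S) where

  N n : ℕ
  N = suc M
  n = suc N

  -- The greedy start vertices; T₀ covers {0, …, c}, so it plays the role of the
  -- window 1, …, c and the j-th window starts at 1 + j c modulo N.
  vert : ℕ → ℕ
  vert zero    = 0
  vert (suc j) = suc (suc j * c) % N

  orbit : ℕ → ℕ → List ℕ
  orbit j zero    = []
  orbit j (suc m) = vert j ∷ orbit (suc j) m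

  length-orbit : ∀ j m → length (orbit j m) ≡ m
  length-orbit j zero    = refl
  length-orbit j (suc m) = cong suc (length-orbit (suc j) m)

  vert-next : ∀ j → (vert (suc j) + c) % N ≡ vert (suc (suc j))
  vert-next j = begin
    (x % N + c) % N             ≡⟨ %-distribˡ-+ (x % N) c N ⟩
    (x % N % N + c % N) % N     ≡⟨ cong (λ z → (z + c % N) % N) (m<n⇒m%n≡m (m%n<n x N)) ⟩
    (x % N + c % N) % N         ≡⟨ %-distribˡ-+ x c N ⟨
    (x + c) % N                 ≡⟨ cong (_% N) (cong suc (ℕ.+-comm (suc j * c) c)) ⟩
    suc (suc (suc j) * c) % N   ∎
    where
    open ≡-Reasoning
    x = suc (suc j * c)

  loop-stop : ∀ f v → v < 2 → greedyLoop c n f v ≡ []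
  loop-stop zero    v             _ = refl
  loop-stop (suc f) zero          _ = refl
  loop-stop (suc f) (suc zero)    _ = refl
  loop-stop (suc f) (suc (suc v)) (s≤s (s≤s ()))

  loop-step : ∀ f v → 2 ≤ v → greedyLoop c n (suc f) v ≡ v ∷ greedyLoop c n f ((v + c) % N)
  loop-step f (suc (suc v)) _ = refl
  loop-step f (suc zero)    (s≤s ())

  -- `m` counts the windows left: `interior` keeps the loop running before index `w`, and `return`
  -- stops it there.
  loop-orbit : ∀ m f j → m + suc j ≡ w → m ≤ f → greedyLoop c n f (vert (suc j)) ≡ orbit (suc j) m
  loop-orbit zero    f       j refl _         = loop-stop f (vert (suc j)) return
  loop-orbit (suc m) (suc f) j eq   (s≤s m≤f) =
    trans (loop-step f (vert (suc j)) (interior (suc j) (s≤s z≤n) (subst (suc j <_) eq (s≤s (ℕ.m≤n+m (suc j) m)))))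
      (cong (vert (suc j) ∷_) (trans (cong (greedyLoop c n f) (vert-next j))
        (loop-orbit m f (suc j) (trans (ℕ.+-suc m (suc j)) eq) m≤f)))

  vert-1 : vert 1 ≡ suc c
  vert-1 = trans (cong (λ z → suc z % N) (ℕ.*-identityˡ c)) (m<n⇒m%n≡m c+2≤N)

  w≡ : suc (w ∸ 1) ≡ w
  w≡ = ℕ.suc-pred w

  greedyVerts-orbit : greedyVerts c n ≡ 0 ∷ orbit 1 (w ∸ 1)
  greedyVerts-orbit = cong (0 ∷_) (trans (cong (greedyLoop c n n) (sym vert-1))
    (loop-orbit (w ∸ 1) n 0 (trans (ℕ.+-comm (w ∸ 1) 1) w≡) (ℕ.≤-trans (ℕ.m∸n≤m w 1) (ℕ.m≤n⇒m≤1+n w≤n))))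

  length-greedyVerts : length (greedyVerts c n) ≡ w
  length-greedyVerts = trans (cong length greedyVerts-orbit) (trans (cong suc (length-orbit 1 (w ∸ 1))) w≡)

  module _ {v} (v<n : v < n) (v≢1 : v ≢ 1) where

    covers-hit : ∀ {u} → u < n → HitsEnd n c v → InCyc n v (suc c) u → covers (S v) u ≡ true
    covers-hit u<n hits u∈ = Equivalence.from (proj₁ (proj₂ (efficient v v<n v≢1)) hits _ u<n) u∈

    covers-inner : ∀ {u} → u < n → InCyc n v c u → covers (S v) u ≡ true
    covers-inner {u} u<n (t , t<c , eq) with covers (S v) u in cov
    ... | true  = refl
    -- The split is on the Boolean, not on `HitsEnd`: if `u` is missed, the window cannot touch an
    -- end, for its longer block would contain `u`; then the block of length `c` contains `u`.
    ... | false = trans (sym cov) (Equivalence.from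
      (proj₂ (proj₂ (efficient v v<n v≢1))
        (λ hits → contradiction (trans (sym cov) (covers-hit u<n hits (t , ℕ.m<n⇒m<1+n t<c , eq))) λ ()) u u<n)
      (t , t<c , eq))

  hit-count : ℕ → ℕ → ℕ → ℕ
  hit-count u j m = countTrue (orbit j m) (λ v → covers (S v) u)

  telescope : ∀ u a j m →
    (∀ i → j ≤ i → i < j + m → (i * c + a + c) / N ≤ bit (covers (S (vert i)) u) + (i * c + a) / N) →
    ((j + m) * c + a) / N ≤ hit-count u j m + (j * c + a) / N
  telescope u a j zero    step = ℕ.≤-reflexive (cong (λ z → (z * c + a) / N) (ℕ.+-identityʳ j))
  telescope u a j (suc m) step = begin
    ((j + suc m) * c + a) / N                           ≡⟨ cong (λ z → (z * c + a) / N) (ℕ.+-suc j m) ⟩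
    ((suc j + m) * c + a) / N                           ≤⟨ telescope u a (suc j) m (λ i j<i i< → step i (ℕ.<⇒≤ j<i) (subst (i <_) (sym (ℕ.+-suc j m)) i<)) ⟩
    hit-count u (suc j) m + (suc j * c + a) / N         ≡⟨ cong (λ z → hit-count u (suc j) m + z / N) (swap c (j * c) a) ⟩
    hit-count u (suc j) m + (j * c + a + c) / N         ≤⟨ ℕ.+-monoʳ-≤ (hit-count u (suc j) m) (step j ℕ.≤-refl (ℕ.m<m+n j (s≤s z≤n))) ⟩
    hit-count u (suc j) m + (bit (covers (S (vert j)) u) + (j * c + a) / N)
                                                        ≡⟨ swap′ (hit-count u (suc j) m) (bit (covers (S (vert j)) u)) ((j * c + a) / N) ⟩
    hit-count u j (suc m) + (j * c + a) / N             ∎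
    where
    open ℕ.≤-Reasoning
    swap : ∀ x y z → x + y + z ≡ y + z + x
    swap = solve-∀
    swap′ : ∀ x y z → x + (y + z) ≡ y + x + z
    swap′ = solve-∀

  c≤N : c ≤ N
  c≤N = ℕ.≤-trans (ℕ.m≤n+m c 2) c+2≤N

  module Orbit (j : ℕ) (j<w : suc j < w) where

    v s : ℕ
    v = vert (suc j)
    s = suc (suc j * c) / N

    v-spec : suc (suc j * c) ≡ v + s * N
    v-spec = m≡m%n+[m/n]*n (suc (suc j * c)) N

    2≤v : 2 ≤ v
    2≤v = interior (suc j) (s≤s z≤n) j<w

    v<N : v < N
    v<N = m%n<n (suc (suc j * c)) N

    v<n : v < n
    v<n = ℕ.m<n⇒m<1+n v<N

    v≢1 : v ≢ 1
    v≢1 v≡1 = ℕ.<⇒≢ 2≤v (sym v≡1)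

    residue : ∀ {u t q} → u < N → v + t + s * N ≡ u + q * N → (v + t) % N ≡ u
    residue {u} {t} {q} u<N eq =
      trans (sym ([m+kn]%n≡m%n (v + t) s N)) (trans (cong (_% N) eq) (trans ([m+kn]%n≡m%n u q N) (m<n⇒m%n≡m u<N)))

    -- `v + t < 2 * N`, so a window goes past `N` at most once.
    unwrap : ∀ {u t q} → u < N → t ≤ c → v + t + s * N ≡ u + q * N → v + t ≡ u ⊎ v + t ≡ u + N
    unwrap {u} {t} {q} u<N t≤c eq = by-quotient ((v + t) / N) (m<n*o⇒m/o<n {o = N} small)
      (trans (m≡m%n+[m/n]*n (v + t) N) (cong (_+ (v + t) / N * N) (residue {u} {t} {q} u<N eq)))
      where
      small : v + t < 2 * N
      small = ℕ.<-≤-trans (ℕ.+-mono-<-≤ v<N (ℕ.≤-trans t≤c c≤N)) (ℕ.≤-reflexive (cong (N +_) (sym (ℕ.+-identityʳ N))))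
      by-quotient : ∀ z → z < 2 → v + t ≡ u + z * N → v + t ≡ u ⊎ v + t ≡ u + N
      by-quotient zero          _ split = inj₁ (trans split (ℕ.+-identityʳ u))
      by-quotient (suc zero)    _ split = inj₂ (trans split (cong (u +_) (ℕ.+-identityʳ N)))
      by-quotient (suc (suc z)) (s≤s (s≤s ()))

    reach-end : ∀ {t q} → t ≤ c → suc (suc j * c) + t ≡ q * N → v + t ≡ N
    reach-end {t} {q} t≤c eq with unwrap {0} {t} {q} (s≤s z≤n) t≤c (trans (swap v t (s * N)) (trans (cong (_+ t) (sym v-spec)) eq))
      where
      swap : ∀ x y z → x + y + z ≡ x + z + y
      swap = solve-∀
    ... | inj₂ v+t≡N = v+t≡N
    ... | inj₁ v+t≡0 = contradiction (ℕ.m+n≡0⇒m≡0 v v+t≡0) λ v≡0 → contradiction (subst (2 ≤_) v≡0 2≤v) λ ()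

    at-N : ∀ {t} → t ≤ c → v + t ≡ N → InCyc n v (suc c) N
    at-N t≤c v+t≡N = _ , s≤s t≤c , trans (cong (_% n) v+t≡N) (m<n⇒m%n≡m ℕ.≤-refl)

    covers-N : ∀ {t} → t ≤ c → v + t ≡ N → covers (S v) N ≡ true
    covers-N t≤c v+t≡N = covers-hit v<n v≢1 ℕ.≤-refl (N , inj₂ refl , at-N t≤c v+t≡N) (at-N t≤c v+t≡N)

    -- Modulo `n = N + 1`, vertex 0 comes right after `N`, at offset `t + 1`, still inside the block
    -- of length `c + 1`.
    covers-0 : ∀ {t} → t < c → v + t ≡ N → covers (S v) 0 ≡ true
    covers-0 {t} t<c v+t≡N = covers-hit v<n v≢1 (s≤s z≤n) (0 , inj₁ refl , at-0) at-0
      where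
      at-0 : InCyc n v (suc c) 0
      at-0 = suc t , s≤s t<c , trans (cong (_% n) (trans (ℕ.+-suc v t) (cong suc v+t≡N))) (n%n≡0 n)

    covers-middle : ∀ {u t} → 0 < u → u < N → t < c → v + t ≡ u ⊎ v + t ≡ u + N → covers (S v) u ≡ true
    covers-middle {u} {t} 0<u u<N t<c (inj₁ v+t≡u) = covers-inner v<n v≢1 (ℕ.m<n⇒m<1+n u<N)
      (t , t<c , trans (cong (_% n) v+t≡u) (m<n⇒m%n≡m (ℕ.m<n⇒m<1+n u<N)))
    -- A window passing `N` hits an end and gains one vertex. This makes up for 0 and `N` being
    -- distinct on the path: modulo `n`, `u` is at offset `t + 1`.
    covers-middle {u} {t} 0<u u<N t<c (inj₂ v+t≡u+N) = covers-hit v<n v≢1 (ℕ.m<n⇒m<1+n u<N)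
      (N , inj₂ refl , at-N N∸v≤c (ℕ.m+[n∸m]≡n (ℕ.<⇒≤ v<N)))
      (suc t , s≤s t<c , trans (cong (_% n) (trans (ℕ.+-suc v t) (trans (cong suc v+t≡u+N) (sym (ℕ.+-suc u N)))))
        (trans ([m+n]%n≡m%n u n) (m<n⇒m%n≡m (ℕ.m<n⇒m<1+n u<N))))
      where
      N∸v≤c : N ∸ v ≤ c
      N∸v≤c = ℕ.≤-trans (ℕ.m≤n+o⇒m∸n≤o N v (ℕ.≤-trans (ℕ.m≤n+m N u) (ℕ.≤-reflexive (sym v+t≡u+N)))) (ℕ.<⇒≤ t<c)

  covers-start : ∀ {u} → u ≤ c → covers (S 0) u ≡ true
  covers-start {u} u≤c = covers-hit (s≤s z≤n) (λ ()) u<n (0 , inj₁ refl , 0 , s≤s z≤n , refl)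
    (u , s≤s u≤c , m<n⇒m%n≡m u<n)
    where
    u<n : u < n
    u<n = s≤s (ℕ.≤-trans u≤c c≤N)

  -- The shift `a = N - u` puts a multiple of `N` at `suc (i * c + a) + t` exactly when
  -- `suc (i * c) + t` is congruent to `u` modulo `N`.
  step-middle : ∀ u a → 0 < u → 0 < a → a + u ≡ N → ∀ i → i < w →
    (i * c + a + c) / N ≤ bit (covers (S (vert i)) u) + (i * c + a) / N
  step-middle u a 0<u 0<a a+u≡N zero i<w = floor-step a c N (covers (S 0) u) c≤N hit
    where
    hit : ∀ q t → suc a + t ≡ q * N → t < c → covers (S 0) u ≡ true
    hit (suc zero)    t eq t<c = covers-start (subst (_≤ c) (sym u≡1+t) t<c)
      where
      u≡1+t : u ≡ suc t
      u≡1+t = ℕ.+-cancelˡ-≡ a u (suc t) (trans a+u≡N (trans (sym (ℕ.+-identityʳ N)) (trans (sym eq) (sym (ℕ.+-suc a t)))))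
    hit (suc (suc q)) t eq t<c = contradiction
      (ℕ.≤-trans (ℕ.+-monoʳ-≤ N (ℕ.m≤m+n N (q * N))) (ℕ.≤-reflexive (sym eq)))
      (ℕ.<⇒≱ (ℕ.+-mono-≤-< (ℕ.≤-trans (ℕ.m<m+n a 0<u) (ℕ.≤-reflexive a+u≡N)) (ℕ.<-≤-trans t<c c≤N)))
  step-middle u a 0<u 0<a a+u≡N (suc j) j<w = floor-step (suc j * c + a) c N (covers (S v) u) c≤N hit
    where
    open Orbit j j<w
    hit : ∀ q t → suc (suc j * c + a) + t ≡ q * N → t < c → covers (S v) u ≡ true
    hit (suc q) t eq t<c = covers-middle 0<u u<N t<c (unwrap {u} {t} {q} u<N (ℕ.<⇒≤ t<c) (ℕ.+-cancelˡ-≡ a _ _ (begin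
      a + (v + t + s * N)             ≡⟨ gather a v t (s * N) ⟩
      (v + s * N) + (a + t)           ≡⟨ cong (_+ (a + t)) v-spec ⟨
      suc (suc j * c) + (a + t)       ≡⟨ ℕ.+-assoc (suc (suc j * c)) a t ⟨
      suc (suc j * c + a) + t         ≡⟨ eq ⟩
      N + q * N                       ≡⟨ cong (_+ q * N) a+u≡N ⟨
      a + u + q * N                   ≡⟨ ℕ.+-assoc a u (q * N) ⟩
      a + (u + q * N)                 ∎)))
      where
      open ≡-Reasoning
      gather : ∀ x y z t → x + (y + z + t) ≡ (y + t) + (x + z)
      gather = solve-∀
      u<N : u < N
      u<N = ℕ.<-≤-trans (ℕ.m<n+m u 0<a) (ℕ.≤-reflexive a+u≡N)

  -- With shift 1, a jump places `N` at offset `t + 1 ≤ c`, within the block of length `c + 1`. The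
  -- first window causes no jump because `c + 2 ≤ N`.
  step-N : ∀ i → i < w → (i * c + 1 + c) / N ≤ bit (covers (S (vert i)) N) + (i * c + 1) / N
  step-N zero    i<w = floor-step 1 c N (covers (S 0) N) c≤N hit
    where
    hit : ∀ q t → suc (suc t) ≡ q * N → t < c → covers (S 0) N ≡ true
    hit (suc q) t eq t<c = contradiction
      (ℕ.≤-trans (ℕ.m≤m+n N (q * N)) (ℕ.≤-reflexive (sym eq)))
      (ℕ.<⇒≱ (ℕ.<-≤-trans (s≤s (s≤s t<c)) c+2≤N))
  step-N (suc j) j<w = floor-step (suc j * c + 1) c N (covers (S v) N) c≤N λ q t eq t<c →
    covers-N t<c (reach-end {suc t} {q} t<c (trans (shift (suc j * c) t) eq))
    where
    open Orbit j j<w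
    shift : ∀ x t → suc x + suc t ≡ suc (x + 1) + t
    shift = solve-∀

  step-0 : ∀ j → suc j < w → (suc j * c + 0 + c) / N ≤ bit (covers (S (vert (suc j))) 0) + (suc j * c + 0) / N
  step-0 j j<w = floor-step (suc j * c + 0) c N (covers (S v) 0) c≤N λ q t eq t<c →
    covers-0 t<c (reach-end {t} {q} (ℕ.<⇒≤ t<c) (trans (cong (λ z → suc (z + t)) (sym (ℕ.+-identityʳ (suc j * c)))) eq))
    where open Orbit j j<w

  weight : ℕ → ℕ
  weight u = hit-count u 0 (suc (w ∸ 1))

  -- A positive shift absorbs the possible defect 1 in `h * N ≤ w * c + 1`, and `a < N` makes the
  -- initial floor vanish.
  weight-from-floor : ∀ u a → 0 < a → a < N →
    (∀ i → i < w → (i * c + a + c) / N ≤ bit (covers (S (vert i)) u) + (i * c + a) / N) → h ≤ weight u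
  weight-from-floor u a 0<a a<N step = begin
    h                                     ≤⟨ *≤⇒≤/ N (ℕ.≤-trans h*N≤w*c+1 (ℕ.+-monoʳ-≤ (w * c) 0<a)) ⟩
    (w * c + a) / N                       ≡⟨ cong (λ z → (z * c + a) / N) w≡ ⟨
    (suc (w ∸ 1) * c + a) / N             ≤⟨ telescope u a 0 (suc (w ∸ 1)) (λ i _ i< → step i (subst (i <_) w≡ i<)) ⟩
    weight u + a / N                      ≡⟨ cong (weight u +_) (m<n⇒m/n≡0 a<N) ⟩
    weight u + 0                          ≡⟨ ℕ.+-identityʳ (weight u) ⟩
    weight u                              ∎
    where open ℕ.≤-Reasoning

  -- With shift 0 the final floor is only known to be at least `h - 1`. The missing hit is `S 0`,
  -- which covers 0 although the floor does not jump over the first window.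
  weight-0 : h ≤ weight 0
  weight-0 = begin
    h                                                  ≡⟨ ℕ.suc-pred h ⟨
    suc (h ∸ 1)                                        ≤⟨ s≤s (*≤⇒≤/ N fits) ⟩
    suc ((w * c + 0) / N)                              ≡⟨ cong (λ z → suc ((z * c + 0) / N)) w≡ ⟨
    suc ((suc (w ∸ 1) * c + 0) / N)                    ≤⟨ s≤s (telescope 0 0 1 (w ∸ 1) later) ⟩
    suc (hit-count 0 1 (w ∸ 1) + (1 * c + 0) / N)      ≡⟨ cong (λ z → suc (hit-count 0 1 (w ∸ 1) + z)) (m<n⇒m/n≡0 c<N) ⟩
    suc (hit-count 0 1 (w ∸ 1) + 0)                    ≡⟨ cong suc (ℕ.+-identityʳ (hit-count 0 1 (w ∸ 1))) ⟩
    suc (hit-count 0 1 (w ∸ 1))                        ≡⟨ cong (λ b → bit b + hit-count 0 1 (w ∸ 1)) (covers-start z≤n) ⟨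
    weight 0                                           ∎
    where
    open ℕ.≤-Reasoning
    c<N : 1 * c + 0 < N
    c<N = subst (_< N) (sym (trans (ℕ.+-identityʳ (1 * c)) (ℕ.*-identityˡ c))) (ℕ.<⇒≤ c+2≤N)
    fits : (h ∸ 1) * N ≤ w * c + 0
    fits = ℕ.+-cancelˡ-≤ 1 _ _ (begin
      1 + (h ∸ 1) * N           ≤⟨ ℕ.+-monoˡ-≤ ((h ∸ 1) * N) (s≤s z≤n) ⟩
      suc (h ∸ 1) * N           ≡⟨ cong (_* N) (ℕ.suc-pred h) ⟩
      h * N                     ≤⟨ h*N≤w*c+1 ⟩
      w * c + 1                 ≡⟨ ℕ.+-comm (w * c) 1 ⟩
      1 + w * c                 ≡⟨ cong suc (ℕ.+-identityʳ (w * c)) ⟨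
      1 + (w * c + 0)           ∎)
    later : ∀ i → 1 ≤ i → i < suc (w ∸ 1) → (i * c + 0 + c) / N ≤ bit (covers (S (vert i)) 0) + (i * c + 0) / N
    later (suc j) _ j< = step-0 j (subst (suc j <_) w≡ j<)

  1<N : 1 < N
  1<N = ℕ.≤-trans (s≤s (s≤s z≤n)) c+2≤N

  weight-≥ : ∀ u → u < n → h ≤ weight u
  weight-≥ zero    _ = weight-0
  weight-≥ (suc u) u<n with ℕ.m≤n⇒m<n∨m≡n (ℕ.≤-pred u<n)
  ... | inj₂ refl = weight-from-floor (suc u) 1 (s≤s z≤n) 1<N step-N
  ... | inj₁ u<N  = weight-from-floor (suc u) (N ∸ suc u) (ℕ.m<n⇒0<n∸m u<N) (ℕ.∸-monoʳ-< (s≤s z≤n) (ℕ.<⇒≤ u<N))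
    (step-middle (suc u) (N ∸ suc u) (s≤s z≤n) (ℕ.m<n⇒0<n∸m u<N) (ℕ.m∸n+n≡m (ℕ.<⇒≤ u<N)))

  L : ℕ
  L = length (greedyVerts c n)

  open Uniform n L S

  heights : ∀ m j → j + m ≤ w → All (λ v → height (S v) ≤ k) (orbit j m)
  heights zero    j       _     = []
  heights (suc m) zero    le    = proj₁ (efficient 0 (s≤s z≤n) (λ ())) ∷ heights m 1 le
  heights (suc m) (suc j) le    = proj₁ (efficient v v<n v≢1) ∷ heights m (suc (suc j)) (subst (_≤ w) (cong suc (ℕ.+-suc j m)) le)
    where open Orbit j (ℕ.<-≤-trans (ℕ.m<m+n (suc j) (s≤s z≤n)) le)

  greedy-optimal : SeekerOptimal k n (frac h w) (greedyX n c S)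
  greedy-optimal =
    (valid k (greedyVerts c n) (subst (All _) (sym greedyVerts-orbit) (heights (suc (w ∸ 1)) 0 (ℕ.≤-reflexive w≡))) ,
     trans (total (greedyVerts c n)) (frac-1 L {{subst NonZero (sym length-greedyVerts) it}})) ,
    λ u u<n → subst (frac h w ℚ.≤_) (sym (coverProb-uniform u (greedyVerts c n)))
      (frac-mono-≤ {h} {w} {countTrue (greedyVerts c n) (λ v → covers (S v) u)} {L}
        {{it}} {{subst NonZero (sym length-greedyVerts) it}}
        (subst₂ (λ vs l → h * l ≤ countTrue vs (λ v → covers (S v) u) * w) (sym greedyVerts-orbit) (sym length-greedyVerts)
          (ℕ.*-monoˡ-≤ w (weight-≥ u u<n))))

-- Arithmetic of the minimal pair `h`, `w`.

module Minimal (c M h w : ℕ) (0<c : 0 < c) (c+2≤N : suc (suc c) ≤ suc M) (minHW : MinHW c (suc (suc M)) h w) where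

  N : ℕ
  N = suc M

  0<h : 0 < h
  0<h = proj₁ (proj₁ minHW)

  0<w : 0 < w
  0<w = proj₁ (proj₂ (proj₁ minHW))

  w≤M : w ≤ M
  w≤M = proj₁ (proj₂ (proj₂ (proj₁ minHW)))

  coprime-eq : gcd c N ≡ 1 → h * N ≡ w * c + 1
  coprime-eq = proj₁ (proj₂ (proj₂ (proj₂ (proj₁ minHW))))

  common-eq : gcd c N ≢ 1 → h * N ≡ w * c
  common-eq = proj₂ (proj₂ (proj₂ (proj₂ (proj₁ minHW))))

  least : ∀ h′ w′ → HW c (suc N) h′ w′ → w ≤ w′
  least = proj₂ minHW

  h*N≤w*c+1 : h * N ≤ w * c + 1
  h*N≤w*c+1 with gcd c N ℕ.≟ 1
  ... | yes g≡1 = ℕ.≤-reflexive (coprime-eq g≡1)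
  ... | no  g≢1 = ℕ.≤-trans (ℕ.≤-reflexive (common-eq g≢1)) (ℕ.m≤m+n (w * c) 1)

  return : suc (w * c) % N < 2
  return with gcd c N ℕ.≟ 1
  ... | yes g≡1 = subst (_< 2) (sym (trans (cong (_% N) (trans (ℕ.+-comm 1 (w * c)) (sym (coprime-eq g≡1)))) (m*n%n≡0 h N))) (s≤s z≤n)
  ... | no  g≢1 = subst (_< 2) (sym (trans (cong (λ z → suc z % N) (sym (common-eq g≢1)))
    (trans ([m+kn]%n≡m%n 1 h N) (m<n⇒m%n≡m (ℕ.≤-trans (s≤s (s≤s z≤n)) c+2≤N))))) ℕ.≤-refl

  -- Otherwise the orbit is back at 1 too early. In the coprime case `N` would divide `j < N`; in
  -- the other case `q` and `j` would satisfy `HW` against the minimality of `w`.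
  no-return-1 : ∀ j q → 0 < j → j < w → j * c ≢ q * N
  no-return-1 j q 0<j j<w eq with gcd c N ℕ.≟ 1
  ... | yes g≡1 = contradiction (∣⇒≤ {{ℕ.>-nonZero 0<j}} N∣j) (ℕ.<⇒≱ (ℕ.<-≤-trans j<w (ℕ.m≤n⇒m≤1+n w≤M)))
    where
    N∣j : N ∣ j
    N∣j = coprime-divisor (coprime-sym (gcd≡1⇒coprime {c} g≡1)) (divides q (trans (ℕ.*-comm c j) eq))
  ... | no  g≢1 = contradiction
    (least q j (0<q q eq , 0<j , ℕ.≤-trans (ℕ.<⇒≤ j<w) w≤M , (λ g≡1 → contradiction g≡1 g≢1) , λ _ → sym eq))
    (ℕ.<⇒≱ j<w)
    where
    0<q : ∀ q → j * c ≡ q * N → 0 < q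
    0<q zero    j*c≡0 = contradiction j*c≡0 (ℕ.m<n⇒n≢0 (ℕ.*-mono-≤ 0<j 0<c))
    0<q (suc _) _     = s≤s z≤n

  -- The two cases trade roles: an early visit to 0 contradicts minimality if the gcd is 1, and
  -- otherwise the gcd would divide 1.
  no-return-0 : ∀ j q → 0 < j → j < w → suc (j * c) ≢ q * N
  no-return-0 j zero    _   _   ()
  no-return-0 j (suc q) 0<j j<w eq with gcd c N ℕ.≟ 1
  ... | yes g≡1 = contradiction
    (least (suc q) j (s≤s z≤n , 0<j , ℕ.≤-trans (ℕ.<⇒≤ j<w) w≤M ,
      (λ _ → trans (sym eq) (ℕ.+-comm 1 (j * c))) , λ g≢1 → contradiction g≡1 g≢1))
    (ℕ.<⇒≱ j<w)
  ... | no  g≢1 = contradiction (∣1⇒≡1 (∣m+n∣m⇒∣n {gcd c N} {j * c} {1}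
      (subst (gcd c N ∣_) (trans (sym eq) (ℕ.+-comm 1 (j * c))) (∣-trans (gcd[m,n]∣n c N) (n∣m*n (suc q))))
      (∣-trans (gcd[m,n]∣m c N) (n∣m*n j)))) g≢1

  interior : ∀ j → 0 < j → j < w → 2 ≤ suc (j * c) % N
  interior j 0<j j<w with suc (j * c) % N in res
  ... | zero        = contradiction (trans (m≡m%n+[m/n]*n (suc (j * c)) N) (cong (_+ q * N) res)) (no-return-0 j q 0<j j<w)
    where q = suc (j * c) / N
  ... | suc zero    = contradiction (ℕ.suc-injective (trans (m≡m%n+[m/n]*n (suc (j * c)) N) (cong (_+ q * N) res)))
    (no-return-1 j q 0<j j<w)
    where q = suc (j * c) / N
  ... | suc (suc _) = s≤s (s≤s z≤n)

  -- If `h > c`, then `h * N ≥ (c + 1) * (M + 1) > M * c + 1 ≥ w * c + 1`. The bound makes every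
  -- segment nonempty.
  h≤c : gcd c N ≡ 1 → h ≤ c
  h≤c g≡1 = ℕ.≮⇒≥ λ c<h → ℕ.<⇒≱ (begin-strict
    w * c + 1               ≤⟨ ℕ.+-monoˡ-≤ 1 (ℕ.*-monoˡ-≤ c w≤M) ⟩
    M * c + 1               <⟨ ℕ.+-monoʳ-< (M * c) (s≤s 0<c) ⟩
    M * c + suc c           ≤⟨ ℕ.m≤m+n _ M ⟩
    M * c + suc c + M       ≡⟨ expand M c ⟩
    suc c * N               ≤⟨ ℕ.*-monoˡ-≤ N c<h ⟩
    h * N                   ∎) (ℕ.≤-reflexive (coprime-eq g≡1))
    where
    open ℕ.≤-Reasoning
    expand : ∀ m c → m * c + suc c + m ≡ suc c * suc m
    expand = solve-∀

  module Common (1<g : 1 < gcd c N) where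

    g : ℕ
    g = gcd c N

    instance
      g-nonZero : NonZero g
      g-nonZero = ℕ.>-nonZero (ℕ.<⇒≤ 1<g)

    g≢1 : g ≢ 1
    g≢1 g≡1 = ℕ.<⇒≢ 1<g (sym g≡1)

    c′ N′ : ℕ
    c′ = c / g
    N′ = N / g

    c≡ : c′ * g ≡ c
    c≡ = m/n*n≡m (gcd[m,n]∣m c N)

    N≡ : N′ * g ≡ N
    N≡ = m/n*n≡m (gcd[m,n]∣n c N)

    0<c′ : 0 < c′
    0<c′ = m≥n⇒m/n>0 (∣⇒≤ {{ℕ.>-nonZero 0<c}} (gcd[m,n]∣m c N))

    0<N′ : 0 < N′
    0<N′ = m≥n⇒m/n>0 (∣⇒≤ (gcd[m,n]∣n c N))

    cross : c′ * N ≡ N′ * c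
    cross = trans (cong (c′ *_) (sym N≡)) (trans (swap c′ N′ g) (cong (N′ *_) c≡))
      where
      swap : ∀ x y z → x * (y * z) ≡ y * (x * z)
      swap = solve-∀

    N′≤M : N′ ≤ M
    N′≤M = ℕ.≤-pred (begin
      1 + N′        ≤⟨ ℕ.+-monoˡ-≤ N′ 0<N′ ⟩
      N′ + N′       ≡⟨ double N′ ⟩
      N′ * 2        ≤⟨ ℕ.*-monoʳ-≤ N′ 1<g ⟩
      N′ * g        ≡⟨ N≡ ⟩
      N             ∎)
      where
      open ℕ.≤-Reasoning
      double : ∀ x → x + x ≡ x * 2
      double = solve-∀

    reduced : h * N′ ≡ w * c′
    reduced = ℕ.*-cancelʳ-≡ (h * N′) (w * c′) g (begin
      h * N′ * g     ≡⟨ ℕ.*-assoc h N′ g ⟩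
      h * (N′ * g)   ≡⟨ cong (h *_) N≡ ⟩
      h * N          ≡⟨ common-eq g≢1 ⟩
      w * c          ≡⟨ cong (w *_) c≡ ⟨
      w * (c′ * g)   ≡⟨ ℕ.*-assoc w c′ g ⟨
      w * c′ * g     ∎)
      where open ≡-Reasoning

    -- The reduced pair `c′`, `N′` satisfies `HW`, so `w ≤ N′` by minimality; conversely `N′`
    -- divides `w * c′` and is coprime to `c′`.
    w≡N′ : w ≡ N′
    w≡N′ = ℕ.≤-antisym
      (least c′ N′ (0<c′ , 0<N′ , N′≤M , (λ g≡1 → contradiction g≡1 g≢1) , λ _ → cross))
      (∣⇒≤ {{ℕ.>-nonZero 0<w}} (coprime-divisor (coprime-sym (coprime-/gcd c N))
        (divides h (trans (ℕ.*-comm c′ w) (sym reduced)))))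

    N≡w*g : N ≡ w * g
    N≡w*g = trans (sym N≡) (cong (_* g) (sym w≡N′))

    c≡h*g : c ≡ h * g
    c≡h*g = trans (sym c≡) (cong (_* g) (ℕ.*-cancelʳ-≡ c′ h w {{ℕ.>-nonZero 0<w}}
      (trans (ℕ.*-comm c′ w) (trans (sym reduced) (cong (h *_) (sym w≡N′))))))

-- Assembling the value, the optimal strategies and the equilibria.

yDiv-optimal : ∀ k c d h w M .{{_ : NonZero w}} → 1 < d → suc M ≡ w * d → c ≡ h * d →
  2 ^ k ≡ suc (suc c) → 2 ^ k < suc (suc M) → HiderGuarantee k (suc (suc M)) (frac h w) (yDiv d w)
-- Matching on `d` exposes `d ∸ 1` as a successor, which supplies the `NonZero` instance.
yDiv-optimal k c (suc (suc d′)) h w M _ N≡ refl = DivisorHider.yDiv-guarantee (suc d′) h w M N≡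
yDiv-optimal k c (suc zero) h w M (s≤s ())

theorem3p2 : ∀ (k n : ℕ) → 2 ≤ k → 2 ^ k < n →
    ∀ (h w : ℕ) → MinHW (cOf k) n h w →
    ∀ (T : ℕ → SG n) → Efficient k n (cOf k) T →
    IsValue k n (frac h w)
    × SeekerOptimal k n (frac h w) (greedyX n (cOf k) T)
    × (1 < gcd (cOf k) (n ∸ 1) →
    HiderOptimal k n (frac h w) (yDiv (gcd (cOf k) (n ∸ 1)) w)
    × Nash k n (greedyX n (cOf k) T) (yDiv (gcd (cOf k) (n ∸ 1)) w))
    × (gcd (cOf k) (n ∸ 1) ≡ 1 →
    HiderOptimal k n (frac h w) (segY (cOf k) n h w)
    × Nash k n (greedyX n (cOf k) T) (segY (cOf k) n h w))
theorem3p2 k zero          _   ()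
theorem3p2 k (suc zero)    2≤k (s≤s 2^k≤0) = contradiction (ℕ.≤-trans (ℕ.^-monoʳ-≤ 2 2≤k) 2^k≤0) λ ()
theorem3p2 k (suc (suc M)) 2≤k 2^k<n h w minHW T efficient =
  value , seeker ,
  (λ 1<g → hider-optimal×nash k n x (yDiv (gcd c N) w) seeker (common 1<g)) ,
  (λ g≡1 → hider-optimal×nash k n x (segY c n h w) seeker (coprime g≡1))
  where
  n = suc (suc M)
  c = cOf k
  x = greedyX n c T
  4≤2^k : 4 ≤ 2 ^ k
  4≤2^k = ℕ.^-monoʳ-≤ 2 2≤k
  2^k≡ : 2 ^ k ≡ suc (suc c)
  2^k≡ = trans (sym (ℕ.m∸n+n≡m (ℕ.≤-trans (s≤s (s≤s z≤n)) 4≤2^k))) (ℕ.+-comm c 2)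
  0<c : 0 < c
  0<c = ℕ.<⇒≤ (ℕ.∸-monoˡ-≤ 2 4≤2^k)
  c+2≤N : suc (suc c) ≤ suc M
  c+2≤N = ℕ.≤-trans (ℕ.≤-reflexive (sym 2^k≡)) (ℕ.≤-pred 2^k<n)
  open Minimal c M h w 0<c c+2≤N minHW
  instance
    h-nonZero : NonZero h
    h-nonZero = ℕ.>-nonZero 0<h
    w-nonZero : NonZero w
    w-nonZero = ℕ.>-nonZero 0<w
  seeker : SeekerOptimal k n (frac h w) x
  seeker = Greedy.greedy-optimal k c M h w c+2≤N (ℕ.m≤n⇒m≤1+n w≤M) h*N≤w*c+1 interior return T efficient
  common : (1<g : 1 < gcd c N) → HiderGuarantee k n (frac h w) (yDiv (gcd c N) w)
  common 1<g = yDiv-optimal k c (gcd c N) h w M 1<g N≡w*g c≡h*g 2^k≡ 2^k<n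
    where open Common 1<g
  coprime : gcd c N ≡ 1 → HiderGuarantee k n (frac h w) (segY c n h w)
  coprime g≡1 = SegmentHider.segY-guarantee c h (h≤c g≡1) M w w≤M (coprime-eq g≡1) {k} 2^k≡ 2^k<n
  value : IsValue k n (frac h w)
  value = (x , seeker) , bound (gcd c N ℕ.≟ 1)
    where
    bound : Dec (gcd c N ≡ 1) → ∀ (x′ : Mixed n) → InΔ k n x′ → Σ ℕ λ v → v < n × coverProb n x′ v ℚ.≤ frac h w
    bound (yes g≡1) = uncovered k n (segY c n h w) (coprime g≡1)
    -- The gcd is positive because `N` is, so being different from 1 means exceeding 1.
    bound (no  g≢1) = uncovered k n (yDiv (gcd c N) w) (common (ℕ.≤∧≢⇒< 0<g (λ 1≡g → g≢1 (sym 1≡g))))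
      where
      0<g : 0 < gcd c N
      0<g = ℕ.n≢0⇒n>0 λ g≡0 → contradiction (gcd[m,n]≡0⇒n≡0 c g≡0) λ ()
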